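{- Let $D,Q\in\mathbb N$ with $(D,Q)=1$ and $D/Q>1$, and suppose $D/Q$ is not the square of a rational number. Let $q$ be the smallest (positive) divisor of $Q$ such that $Q\mid q^2$, and put $D_1=Dq^2/Q\in\mathbb N$ and $D_2=DQ$. Let $m\ge 0$ be the smallest integer such that $\sqrt{D/Q}$ has the periodic continued fraction expansion $\sqrt{D/Q}=[b_0,\{b_1,\ldots,b_m,2b_0\}]$ with $b_0,\ldots,b_m\in\mathbb N$, and let $r_k/s_k$, $k=0,1,2,\ldots$, be the $k$th convergent of $\sqrt{D/Q}$. Then the units $>1$ of $\mathbb Z[\sqrt{D_2}]$ are exactly the numbers $r+s\sqrt{D_1}$ with $r,s\in\mathbb Z$ such that $r=r_k$ and $sq=s_k$, where $k=l(m+1)-1$, $l\in\mathbb N$; i.e., the corresponding fractions $r_k/s_k$ are the convergents of $\sqrt{D/Q}$ occurring just before the end of each period (in particular $q\mid s_k$ for each such $k$).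
   Context: $\mathbb N=\{1,2,3,\ldots\}$ and $(a,b)$ denotes the greatest common divisor. The notation $[b_0,\{b_1,\ldots,b_m,2b_0\}]$ denotes the infinite simple continued fraction with initial term $b_0$ followed by the block $b_1,\ldots,b_m,2b_0$ (of length $m+1$) repeated periodically forever; for $D/Q>1$ as in the claim, $\sqrt{D/Q}$ always has an expansion of this form. Convergents $r_k/s_k=[b_0,b_1,\ldots,b_k]$ are indexed from $k=0$ and written in lowest terms with $r_k,s_k\in\mathbb N$, $(r_k,s_k)=1$. Since $D_2=D_1(Q/q)^2$, the ring $\mathbb Z[\sqrt{D_2}]$ is contained in $\mathbb Z[\sqrt{D_1}]$. -}

module Defs where

open import Algebra.Definitions using (Invertible)
open import Data.Integer.Base as ℤ using (ℤ; +_; -[1+_]; 0ℤ; 1ℤ)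
open import Data.Nat.Base as ℕ using (ℕ; zero; suc; NonZero)
open import Data.Nat.DivMod using (_mod_; m*n/n≡m)
open import Data.Nat.Divisibility using (_∣_; divides)
import Data.Nat.Properties as ℕₚ
open import Data.Nat.Solver using (module +-*-Solver)
open import Data.Product.Base using (_×_; _,_; ∃; ∃₂)
open import Data.Rational.Base using (ℚ; mkℚ; 0ℚ; 1ℚ; _+_; _*_; _<_; _/_; 1/_)
open import Data.Sum.Base using (_⊎_)
open import Data.Vec.Base using (Vec; lookup; _∷ʳ_)
open import Data.Vec.Relation.Unary.All using (All)
open import Relation.Binary.PropositionalEquality

-- The real number √ρ (ρ a nonnegative rational) is handled through its
-- Dedekind cut: the rationals below it and the rationals above it.

infix 4 _<√_ _>√_ _⟶√_

_<√_ : ℚ → ℚ → Set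
p <√ ρ = p < 0ℚ ⊎ p * p < ρ

_>√_ : ℚ → ℚ → Set
p >√ ρ = 0ℚ < p × ρ < p * p

-- Convergence to √ρ in the order topology.

_⟶√_ : (ℕ → ℚ) → ℚ → Set
c ⟶√ ρ = ∀ {l u} → l <√ ρ → u >√ ρ →
         ∃ λ N → ∀ k → N ℕ.≤ k → l < c k × c k < u

-- The value at 0 is a junk value; `convergent` below never reaches it
-- when the partial quotients are positive.

recip : ℚ → ℚ
recip   (mkℚ (+ zero)  _ _) = 0ℚ
recip p@(mkℚ (+ suc _) _ _) = 1/ p
recip p@(mkℚ -[1+ _ ]  _ _) = 1/ p

-- convergent a k = [a 0, a 1, …, a k].  Elements of ℚ are in lowest terms,
-- so r_k and s_k are the numerator and the denominator of this value.

convergent : (ℕ → ℕ) → ℕ → ℚ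
convergent a zero    = + a 0 / 1
convergent a (suc k) = + a 0 / 1 + recip (convergent (λ i → a (suc i)) k)

-- Partial quotients of [b₀, {b₁, …, bₘ, 2b₀}].

periodic : ∀ {m} → ℕ → Vec ℕ m → ℕ → ℕ
periodic     b₀ bs zero    = b₀
periodic {m} b₀ bs (suc i) = lookup (bs ∷ʳ (2 ℕ.* b₀)) (i mod suc m)

-- √ρ = [b₀, {b₁, …, bₘ, 2b₀}] with positive integers b₀, …, bₘ.

record √_≐[_,_] (ρ : ℚ) {m : ℕ} (b₀ : ℕ) (bs : Vec ℕ m) : Set where
  field
    b₀-positive : 1 ℕ.≤ b₀
    bs-positive : All (1 ℕ.≤_) bs
    converges   : convergent (periodic b₀ bs) ⟶√ ρ

-- The element x + y√d is stored as the pair (x , y); this is the subring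
-- ℤ[√d] of ℝ whenever d is not a perfect square.

record ℤ[√_] (d : ℕ) : Set where
  constructor _+_√
  field
    re im : ℤ

open ℤ[√_] public

infixl 7 _·_

_·_ : ∀ {d} → ℤ[√ d ] → ℤ[√ d ] → ℤ[√ d ]
_·_ {d} (x + y √) (x′ + y′ √) =
  (x ℤ.* x′ ℤ.+ + d ℤ.* (y ℤ.* y′)) + (x ℤ.* y′ ℤ.+ y ℤ.* x′) √

one : ∀ {d} → ℤ[√ d ]
one = 1ℤ + 0ℤ √

IsUnit : ∀ {d} → ℤ[√ d ] → Set
IsUnit = Invertible _≡_ one _·_

-- The real inequality 1 < x + y√d: t ↦ x + y t is affine, so it holds exactly
-- when 1 < x + y t at both endpoints of some rational interval around √d.

1<_ : ∀ {d} → ℤ[√ d ] → Set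
1<_ {d} (x + y √) = ∃₂ λ l u →
  l <√ (+ d / 1) × u >√ (+ d / 1) ×
  1ℚ < x / 1 + y / 1 * l × 1ℚ < x / 1 + y / 1 * u

-- If e = d c², then √e = c√d, so ℤ[√e] ⊆ ℤ[√d].

include : ∀ {d e} (c : ℕ) → e ≡ d ℕ.* (c ℕ.* c) → ℤ[√ e ] → ℤ[√ d ]
include c _ (x + y √) = x + (y ℤ.* + c) √

record IsLeastDivisorWithMultipleSquare (Q q : ℕ) : Set where
  field
    q∣Q   : q ∣ Q
    Q∣q²  : Q ∣ q ℕ.* q
    least : ∀ q′ → q′ ∣ Q → Q ∣ q′ ℕ.* q′ → q ℕ.≤ q′

-- Natural-number division, exact when Q ∣ q².

D₁ : (D Q q : ℕ) .{{_ : NonZero Q}} → ℕ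
D₁ D Q q = D ℕ.* (q ℕ.* q) ℕ./ Q

D₂ : (D Q : ℕ) → ℕ
D₂ D Q = D ℕ.* Q

D₂≡D₁[Q/q]² : ∀ D Q q .{{_ : NonZero Q}} .{{_ : NonZero q}} →
  IsLeastDivisorWithMultipleSquare Q q →
  D₂ D Q ≡ D₁ D Q q ℕ.* ((Q ℕ./ q) ℕ.* (Q ℕ./ q))
D₂≡D₁[Q/q]² D Q q h = helper q∣Q Q∣q²
  where
  open IsLeastDivisorWithMultipleSquare h
  open +-*-Solver
  open ≡-Reasoning

  helper : q ∣ Q → Q ∣ q ℕ.* q →
    D₂ D Q ≡ D₁ D Q q ℕ.* ((Q ℕ./ q) ℕ.* (Q ℕ./ q))
  helper (divides k Q≡kq) (divides j q²≡jQ) = begin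
    D ℕ.* Q                                         ≡⟨ cong (D ℕ.*_) Q≡jk² ⟩
    D ℕ.* (j ℕ.* (k ℕ.* k))                         ≡⟨ ℕₚ.*-assoc D j _ ⟨
    D ℕ.* j ℕ.* (k ℕ.* k)                           ≡⟨ cong₂ (λ a b → a ℕ.* (b ℕ.* b)) D₁≡Dj Q/q≡k ⟨
    D₁ D Q q ℕ.* ((Q ℕ./ q) ℕ.* (Q ℕ./ q))          ∎
    where
    Q/q≡k : Q ℕ./ q ≡ k
    Q/q≡k = trans (cong (ℕ._/ q) Q≡kq) (m*n/n≡m k q)

    D₁≡Dj : D₁ D Q q ≡ D ℕ.* j
    D₁≡Dj = begin
      D ℕ.* (q ℕ.* q) ℕ./ Q   ≡⟨ cong (λ t → D ℕ.* t ℕ./ Q) q²≡jQ ⟩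
      D ℕ.* (j ℕ.* Q) ℕ./ Q   ≡⟨ cong (ℕ._/ Q) (ℕₚ.*-assoc D j Q) ⟨
      D ℕ.* j ℕ.* Q ℕ./ Q     ≡⟨ m*n/n≡m (D ℕ.* j) Q ⟩
      D ℕ.* j                 ∎

    Q≡jk² : Q ≡ j ℕ.* (k ℕ.* k)
    Q≡jk² = ℕₚ.*-cancelʳ-≡ Q (j ℕ.* (k ℕ.* k)) Q (begin
      Q ℕ.* Q                           ≡⟨ cong₂ ℕ._*_ Q≡kq Q≡kq ⟩
      k ℕ.* q ℕ.* (k ℕ.* q)             ≡⟨ solve 2 (λ a b → a :* b :* (a :* b) := a :* a :* (b :* b)) refl k q ⟩
      k ℕ.* k ℕ.* (q ℕ.* q)             ≡⟨ cong (k ℕ.* k ℕ.*_) q²≡jQ ⟩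
      k ℕ.* k ℕ.* (j ℕ.* Q)             ≡⟨ solve 3 (λ a b c → a :* a :* (b :* c) := b :* (a :* a) :* c) refl k j Q ⟩
      j ℕ.* (k ℕ.* k) ℕ.* Q             ∎)

module Submission where

-- Let T = (x Dy; Qy x).  If x² − DQy² = ±1, then T is unimodular, fixes √(D/Q) and has columns
-- on both sides of it, hence factors through the partial quotients of √(D/Q).  By uniqueness of
-- the expansion the number of factors is a period, so a multiple of the least one, and the first
-- column x/(Qy) is a convergent just before the end of a period.  Conversely, the matrix of a
-- period fixes √(D/Q), which is irrational, so its entries satisfy the linear relations making
-- it such a T.  Without real numbers the latter is seen as follows: the quadratic form f whose
-- root is the fixed point, and g = Qu² − Dv², both alternate in sign along the convergents and
-- hence stay bounded by their discriminants, which forces f and g to be proportional.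

open import Defs
open import Data.Empty using (⊥; ⊥-elim)
open import Data.Fin.Base as Fin using (Fin; toℕ)
open import Data.Fin.Properties using (fromℕ<-cong; toℕ-fromℕ<)
open import Data.Integer.Base as ℤ using (ℤ; +_; +[1+_]; -[1+_]; 0ℤ; 1ℤ) renaming (_*_ to _*ℤ_)
import Data.Integer.Properties as ℤₚ
import Data.Integer.Solver as ℤ-Solver
open import Data.Nat.Base renaming (_/_ to _div_)
open import Data.Nat.Coprimality using (Coprime; coprime-divisor)
import Data.Nat.Coprimality as Coprimality
open import Data.Nat.DivMod using (_mod_; [m+n]%n≡m%n; m%n<n; m<n⇒m%n≡m; m/n*n≡m; m≡m%n+[m/n]*n)
open import Data.Nat.Divisibility using (_∣_; divides; ∣m⇒∣m*n; ∣n⇒∣m*n; ∣m+n∣m⇒∣n)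
open import Data.Nat.Properties
import Data.Nat.Solver as ℕ-Solver
open import Data.Nat.Tactic.RingSolver using (solve-∀)
open import Data.Product.Base using (_×_; _,_; ∃; ∃₂; proj₁; proj₂)
open import Data.Rational.Base as ℚ using (ℚ; mkℚ; 0ℚ; 1ℚ; _/_; ↥_; ↧_; ↧ₙ_; toℚᵘ; *<*)
  renaming (_<_ to _<ℚ_; _*_ to _*ℚ_)
import Data.Rational.Properties as ℚₚ
open import Data.Rational.Unnormalised.Base as ℚᵘ using (mkℚᵘ)
import Data.Rational.Unnormalised.Properties as ℚᵘₚ
open import Data.Sum.Base as Sum using (_⊎_; inj₁; inj₂)
open import Data.Vec.Base using (Vec; []; _∷_; _∷ʳ_; lookup; tabulate)
open import Data.Vec.Relation.Unary.All using (All; []; _∷_)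
import Data.Vec.Relation.Unary.All.Properties as All
open import Function.Base using (_∘_)
open import Function.Bundles using (_⇔_; mk⇔)
open import Relation.Binary.Definitions using (tri<; tri≈; tri>)
open import Relation.Binary.PropositionalEquality

-- The role of convergence is to place the convergents strictly and alternately on the two sides of
-- √(D/Q), with 1/0 counted as the zeroth one; after that √(D/Q) is handled through the fractions
-- above and below it, and its complete quotients are pulled-back cuts. The factorization of T ends
-- in a translation (1 j; 0 1). Since T fixes √(D/Q), the complete quotient reached there is √(D/Q)
-- + j, whose expansion differs from that of √(D/Q) in the first term only; this is why periods
-- start at `b 1`. Conversely, the final `2 * b₀` of a block is `b₀` plus a translation by `b₀`.
-- Both signs of the norm are treated at once: the sign is the parity of the number of factors.

-- Matrices of partial quotients, parity and orientation.

tail : (ℕ → ℕ) → ℕ → ℕ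
tail a i = a (suc i)

drop : ℕ → (ℕ → ℕ) → ℕ → ℕ
drop n a i = a (n + i)

step : ℕ → ℕ × ℕ → ℕ × ℕ
step c (u , v) = c * u + v , u

-- The product of the matrices (a i  1; 1  0) for i < n, applied to a column vector; the
-- convergent [a 0, …, a k] is act a (k + 1) ∞.

act : (ℕ → ℕ) → ℕ → ℕ × ℕ → ℕ × ℕ
act a zero    w = w
act a (suc n) w = step (a 0) (act (tail a) n w)

∞ : ℕ × ℕ
∞ = 1 , 0

comb : ℕ → ℕ × ℕ → ℕ → ℕ × ℕ → ℕ × ℕ
comb x (u , v) y (u′ , v′) = x * u + y * u′ , x * v + y * v′

act-+ : ∀ a n k w → act a (n + k) w ≡ act a n (act (drop n a) k w)
act-+ a zero    k w = refl
act-+ a (suc n) k w = cong (step (a 0)) (act-+ (tail a) n k w)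

act-cong : ∀ {a b} → (∀ i → a i ≡ b i) → ∀ n w → act a n w ≡ act b n w
act-cong a≗b zero    w = refl
act-cong a≗b (suc n) w = cong₂ step (a≗b 0) (act-cong (λ i → a≗b (suc i)) n w)

step-comb : ∀ c x w y w′ → step c (comb x w y w′) ≡ comb x (step c w) y (step c w′)
step-comb c x (u , v) y (u′ , v′) = cong (_, x * u + y * u′) (lemma c x u v y u′ v′)
  where
  lemma : ∀ c x u v y u′ v′ →
    c * (x * u + y * u′) + (x * v + y * v′) ≡ x * (c * u + v) + y * (c * u′ + v′)
  lemma = solve-∀

act-comb : ∀ a n x w y w′ → act a n (comb x w y w′) ≡ comb x (act a n w) y (act a n w′)
act-comb a zero    x w y w′ = refl
act-comb a (suc n) x w y w′ =
  trans (cong (step (a 0)) (act-comb (tail a) n x w y w′))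
        (step-comb (a 0) x (act (tail a) n w) y (act (tail a) n w′))

-- Holds an `A` for even `n` and a `B` for odd `n`. Swapping the arguments at each `there` matches
-- the reversal of order by each `step`, so inductions on the number of factors need no parity
-- arithmetic.
data Side : ℕ → Set → Set → Set₁ where
  here  : ∀ {A B} → A → Side zero A B
  there : ∀ {n A B} → Side n B A → Side (suc n) A B

Side-map : ∀ {n A B A′ B′} → (A → A′) → (B → B′) → Side n A B → Side n A′ B′
Side-map f g (here a)  = here (f a)
Side-map f g (there s) = there (Side-map g f s)

Side-zip : ∀ {n A B A′ B′ A″ B″} → (A → A′ → A″) → (B → B′ → B″) →
  Side n A B → Side n A′ B′ → Side n A″ B″
Side-zip f g (here a)  (here a′)  = here (f a a′)
Side-zip f g (there s) (there s′) = there (Side-zip g f s s′)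

Side-join : ∀ {n A} → Side n A A → A
Side-join (here a)  = a
Side-join (there s) = Side-join s

infix 4 _⊑_ _⊏_ _⋗_

-- Pairs stand for fractions; w ⋗ w′ says that the matrix with columns w, w′ has determinant 1.

_⊑_ _⊏_ _⋗_ : ℕ × ℕ → ℕ × ℕ → Set
(u , v) ⊑ (u′ , v′) = u * v′ ≤ u′ * v
(u , v) ⊏ (u′ , v′) = u * v′ < u′ * v
(u , v) ⋗ (u′ , v′) = u * v′ ≡ suc (u′ * v)

-- The map t ↦ c + 1/t is decreasing: in a cross-multiplied comparison of two images the summand
-- `c * (u * u′)` is common, and cancelling it leaves the original comparison with its sides
-- exchanged.
step-cross : ∀ c u v u′ v′ → (c * u′ + v′) * u ≡ c * (u * u′) + u * v′
step-cross = solve-∀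

step-cross′ : ∀ c u v u′ v′ → (c * u + v) * u′ ≡ c * (u * u′) + u′ * v
step-cross′ = solve-∀

step-⊑ : ∀ c w w′ → w ⊑ w′ → step c w′ ⊑ step c w
step-⊑ c (u , v) (u′ , v′) h = subst₂ _≤_ (sym (step-cross c u v u′ v′)) (sym (step-cross′ c u v u′ v′))
  (+-monoʳ-≤ (c * (u * u′)) h)

step-⋗ : ∀ c w w′ → w ⋗ w′ → step c w′ ⋗ step c w
step-⋗ c (u , v) (u′ , v′) h = trans (step-cross c u v u′ v′)
  (trans (cong (λ t → c * (u * u′) + t) h)
  (trans (+-suc (c * (u * u′)) (u′ * v)) (cong suc (sym (step-cross′ c u v u′ v′)))))

step-⊏⁻ : ∀ c w w′ → step c w′ ⊏ step c w → w ⊏ w′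
step-⊏⁻ c (u , v) (u′ , v′) h = +-cancelˡ-< (c * (u * u′)) _ _
  (subst₂ _<_ (step-cross c u v u′ v′) (step-cross′ c u v u′ v′) h)

step-⋗⁻ : ∀ c w w′ → step c w′ ⋗ step c w → w ⋗ w′
step-⋗⁻ c (u , v) (u′ , v′) h = +-cancelˡ-≡ (c * (u * u′)) _ _
  (trans (sym (step-cross c u v u′ v′))
  (trans h (trans (cong suc (step-cross′ c u v u′ v′)) (sym (+-suc (c * (u * u′)) (u′ * v))))))

-- 1/0 dominates every fraction, so a convergent bounds, on a side fixed by parity, everything that
-- continues the same partial quotients, in particular all later convergents.
act-⊑ : ∀ a n → Side n (∀ w → act a n w ⊑ act a n ∞) (∀ w → act a n ∞ ⊑ act a n w)
act-⊑ a zero    = here (λ (u , v) → subst (_≤ 1 * v) (sym (*-zeroʳ u)) z≤n)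
act-⊑ a (suc n) = there (Side-map
  (λ h w → step-⊑ (a 0) (act (tail a) n w) (act (tail a) n ∞) (h w))
  (λ h w → step-⊑ (a 0) (act (tail a) n ∞) (act (tail a) n w) (h w))
  (act-⊑ (tail a) n))

act-⋗ : ∀ a n {w w′} → w ⋗ w′ → Side n (act a n w ⋗ act a n w′) (act a n w′ ⋗ act a n w)
act-⋗ a zero    h = here h
act-⋗ a (suc n) {w} {w′} h = there (Side-map
  (step-⋗ (a 0) (act (tail a) n w) (act (tail a) n w′))
  (step-⋗ (a 0) (act (tail a) n w′) (act (tail a) n w))
  (act-⋗ (tail a) n h))

∞⋗ : ∀ j → ∞ ⋗ (j , 1)
∞⋗ j = cong suc (sym (*-zeroʳ j))

-- Cuts and the uniqueness of continued fraction expansions.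

-- A real number θ, through the fractions above θ and those below θ.

record Cut : Set₁ where
  field
    Above Below : ℕ × ℕ → Set
    separated   : ∀ {w w′} → Below w → Above w′ → w ⊏ w′

open Cut

-- The cut of 1/(θ − c), where θ is the given cut.

shift : ℕ → Cut → Cut
shift c C = record
  { Above     = λ w → Below C (step c w)
  ; Below     = λ w → Above C (step c w)
  ; separated = λ {w} {w′} below above → step-⊏⁻ c w w′ (separated C above below)
  }

-- Strict alternation of the convergents around θ, starting with 1/0 above it, stands in for
-- convergence. It passes to the tail under `shift`, and with positive terms it determines the
-- expansion.
Expands : Cut → (ℕ → ℕ) → Set₁
Expands C a = ∀ n → Side n (Above C (act a n ∞)) (Below C (act a n ∞))

Expands-tail : ∀ {C a} → Expands C a → Expands (shift (a 0) C) (tail a)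
Expands-tail e n with e (suc n)
... | there s = s

Positive : (ℕ → ℕ) → Set
Positive a = ∀ i → 1 ≤ a i

head-below : ∀ {C a} → Expands C a → Below C (a 0 , 1)
head-below {C} {a} e with e 1
... | there (here h) = subst (λ k → Below C (k , 1))
  (trans (+-identityʳ (a 0 * 1)) (*-identityʳ (a 0))) h

head-above : ∀ {C a} → Expands C a → Above C (a 0 * a 1 + 1 , a 1)
head-above {C} {a} e with e 2
... | there (there (here h)) = subst (λ k → Above C (a 0 * k + 1 , k))
  (trans (+-identityʳ (a 1 * 1)) (*-identityʳ (a 1))) h

-- The cut would lie above b 0 ≥ a 0 + 1, yet below a 0 + 1/a 1 ≤ a 0 + 1.
head-≮ : ∀ {C a b} → Positive a → Expands C a → Expands C b → a 0 < b 0 → ⊥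
head-≮ {C} {a} {b} a⁺ ea eb a<b = <-irrefl refl (begin-strict
  a 0 * a 1 + a 1   ≡⟨ +-comm (a 0 * a 1) (a 1) ⟩
  suc (a 0) * a 1   ≤⟨ *-monoˡ-≤ (a 1) a<b ⟩
  b 0 * a 1         <⟨ separated C (head-below {C} {b} eb) (head-above {C} {a} ea) ⟩
  (a 0 * a 1 + 1) * 1 ≡⟨ *-identityʳ _ ⟩
  a 0 * a 1 + 1     ≤⟨ +-monoʳ-≤ (a 0 * a 1) (a⁺ 1) ⟩
  a 0 * a 1 + a 1   ∎)
  where open ≤-Reasoning

head-unique : ∀ {C a b} → Positive a → Positive b → Expands C a → Expands C b → a 0 ≡ b 0
head-unique {C} {a} {b} a⁺ b⁺ ea eb with <-cmp (a 0) (b 0)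
... | tri< a<b _ _ = ⊥-elim (head-≮ {C} {a} {b} a⁺ ea eb a<b)
... | tri≈ _ a≡b _ = a≡b
... | tri> _ _ b<a = ⊥-elim (head-≮ {C} {b} {a} b⁺ eb ea b<a)

expansion-unique : ∀ {C a b} → Positive a → Positive b →
  Expands C a → Expands C b → ∀ i → a i ≡ b i
expansion-unique {C} {a} {b} a⁺ b⁺ ea eb zero    = head-unique {C} a⁺ b⁺ ea eb
expansion-unique {C} {a} {b} a⁺ b⁺ ea eb (suc i) =
  expansion-unique {shift (a 0) C} (λ j → a⁺ (suc j)) (λ j → b⁺ (suc j))
    (Expands-tail {C} ea)
    (subst (λ c → Expands (shift c C) (tail b))
      (sym (head-unique {C} a⁺ b⁺ ea eb)) (Expands-tail {C} eb)) i

-- Factorization of unimodular matrices whose columns enclose a cut.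

Straddles : Cut → ℕ × ℕ → ℕ × ℕ → Set
Straddles C w w′ = w ⋗ w′ × Above C w × Below C w′

Adjacent : Cut → ℕ × ℕ → ℕ × ℕ → Set
Adjacent C w w′ = Straddles C w w′ ⊎ Straddles C w′ w

Straddles-step⁻ : ∀ C c w w′ → Straddles C (step c w) (step c w′) → Straddles (shift c C) w′ w
Straddles-step⁻ C c w w′ (d , above , below) = step-⋗⁻ c w′ w d , below , above

Adjacent-step⁻ : ∀ C c w w′ → Adjacent C (step c w) (step c w′) → Adjacent (shift c C) w w′
Adjacent-step⁻ C c w w′ (inj₁ s) = inj₂ (Straddles-step⁻ C c w w′ s)
Adjacent-step⁻ C c w w′ (inj₂ s) = inj₁ (Straddles-step⁻ C c w′ w s)

-- No integer lies strictly between two fractions of determinant ±1.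

head-≤ : ∀ {C a} → Expands C a → ∀ {u v u′ v′} → Straddles C (u , v) (u′ , v′) →
  1 ≤ v → 1 ≤ v′ → a 0 * v ≤ u × a 0 * v′ ≤ u′
head-≤ {C} {a} e {u} {v} {u′} {v′} (det , above , below) 1≤v 1≤v′ =
  <⇒≤ c*v<u , ≮⇒≥ λ u′<c*v′ → <-irrefl refl (begin-strict
    a 0 * v * v′ + v′       <⟨ ≤-reflexive (+-comm 1 _) ⟩
    a 0 * v * v′ + v′ + 1   ≤⟨ +-mono-≤ (≤-reflexive (+-comm (a 0 * v * v′) v′)) 1≤v ⟩
    suc (a 0 * v) * v′ + v  ≤⟨ +-monoˡ-≤ v (*-monoˡ-≤ v′ c*v<u) ⟩
    u * v′ + v              ≡⟨ cong (_+ v) det ⟩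
    suc (u′ * v) + v        ≡⟨ cong suc (+-comm (u′ * v) v) ⟩
    suc (suc u′ * v)        ≤⟨ s≤s (*-monoˡ-≤ v u′<c*v′) ⟩
    suc (a 0 * v′ * v)      ≡⟨ +-comm 1 _ ⟩
    a 0 * v′ * v + 1        ≤⟨ +-monoʳ-≤ (a 0 * v′ * v) 1≤v′ ⟩
    a 0 * v′ * v + v′       ≡⟨ cong (_+ v′) (lemma (a 0) v′ v) ⟩
    a 0 * v * v′ + v′       ∎)
  where
  open ≤-Reasoning
  lemma : ∀ c x y → c * x * y ≡ c * y * x
  lemma = solve-∀
  c*v<u : a 0 * v < u
  c*v<u = subst (a 0 * v <_) (*-identityʳ u) (separated C (head-below {C} {a} e) above)

head-≤′ : ∀ {C a} → Expands C a → ∀ {u v u′ v′} → Adjacent C (u , v) (u′ , v′) →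
  1 ≤ v → 1 ≤ v′ → a 0 * v ≤ u × a 0 * v′ ≤ u′
head-≤′ {C} e (inj₁ s) 1≤v 1≤v′ = head-≤ {C} e s 1≤v 1≤v′
head-≤′ {C} e (inj₂ s) 1≤v 1≤v′ with head-≤ {C} e s 1≤v′ 1≤v
... | p , q = q , p

Adjacent⇒≤ : ∀ C {u v u′ v′} → Adjacent C (u , v) (u′ , v′) → u * v′ ≤ suc (u′ * v)
Adjacent⇒≤ C (inj₁ (d , _)) = ≤-reflexive d
Adjacent⇒≤ C {u} {v} {u′} {v′} (inj₂ (d , _)) = ≤-trans (n≤1+n _) (≤-trans (≤-reflexive (sym d)) (n≤1+n _))

-- Keeps the columns ordered through one Euclidean step. If u′ < u, the determinant uv′ - u′v is at
-- least v′, so v = v′ = 1; then the order of the numerators contradicts u′ < u.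
remainder-≤ : ∀ C {c u v u′ v′} → Adjacent C (c * v + u , v) (c * v′ + u′ , v′) →
  1 ≤ v → v ≤ v′ → c * v + u ≤ c * v′ + u′ → u ≤ u′
remainder-≤ C {c} {u} {v} {u′} {v′} adj 1≤v v≤v′ le = ≮⇒≥ λ u′<u →
  let
    v′≤1 : v′ ≤ 1
    v′≤1 = +-cancelˡ-≤ (c * v * v′ + u′ * v′) v′ 1 (begin
      c * v * v′ + u′ * v′ + v′       ≡⟨ lemma₁ (c * v * v′) (u′ * v′) v′ ⟩
      c * v * v′ + suc u′ * v′        ≤⟨ +-monoʳ-≤ (c * v * v′) (*-monoˡ-≤ v′ u′<u) ⟩
      c * v * v′ + u * v′             ≡⟨ *-distribʳ-+ v′ (c * v) u ⟨
      (c * v + u) * v′                ≤⟨ Adjacent⇒≤ C adj ⟩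
      suc ((c * v′ + u′) * v)         ≡⟨ lemma₂ c v v′ u′ ⟩
      c * v * v′ + u′ * v + 1         ≤⟨ +-monoˡ-≤ 1 (+-monoʳ-≤ (c * v * v′) (*-monoʳ-≤ u′ v≤v′)) ⟩
      c * v * v′ + u′ * v′ + 1        ∎)
    v≡v′ : v ≡ v′
    v≡v′ = ≤-antisym v≤v′ (≤-trans v′≤1 1≤v)
  in <⇒≱ u′<u (+-cancelˡ-≤ (c * v) u u′ (subst (λ t → c * v + u ≤ c * t + u′) (sym v≡v′) le))
  where
  open ≤-Reasoning
  lemma₁ : ∀ x y z → x + y + z ≡ x + (z + y)
  lemma₁ = solve-∀
  lemma₂ : ∀ c v v′ u′ → suc ((c * v′ + u′) * v) ≡ c * v * v′ + u′ * v + 1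
  lemma₂ = solve-∀

-- A unimodular matrix whose columns enclose the cut is a product of the matrices
-- (c 1; 1 0) given by the expansion, up to a final translation (1 j; 0 1).

adjacent-convergent : ∀ N {C a} → Positive a → Expands C a → ∀ {u v u′ v′} → u + v ≤ N →
  Adjacent C (u , v) (u′ , v′) → u ≤ u′ → v ≤ v′ →
  ∃₂ λ n j → (u , v) ≡ act a n ∞ × (u′ , v′) ≡ act a n (j , 1)
adjacent-convergent N {C} a⁺ e {u} {zero} {u′} {v′} _ (inj₂ (d , above , below)) _ _ =
  ⊥-elim (1+n≢0 (sym (trans (sym (*-zeroʳ u′)) d)))
adjacent-convergent N {C} a⁺ e {u} {zero} {u′} {v′} _ (inj₁ (d , above , below)) _ _ =
  -- With v = 0, determinant 1 forces u = v′ = 1: no factor is left and the matrix is the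
  -- translation by `u′`.
  0 , u′ , cong (_, 0) (m*n≡1⇒m≡1 u v′ d′) , cong (u′ ,_) (m*n≡1⇒n≡1 u v′ d′)
  where
  d′ : u * v′ ≡ 1
  d′ = trans d (cong suc (*-zeroʳ u′))
adjacent-convergent zero {C} a⁺ e {u} {suc v} size adj u≤u′ v≤v′
  with () ← n≤0⇒n≡0 (m+n≤o⇒n≤o u size)
adjacent-convergent (suc N) {C} {a} a⁺ e {u} {suc v} {u′} {v′} size adj u≤u′ v≤v′
  with head-≤′ {C} e adj (s≤s z≤n) (≤-trans (s≤s z≤n) v≤v′)
... | cv≤u , cv′≤u′ with m≤n⇒∃[o]m+o≡n cv≤u | m≤n⇒∃[o]m+o≡n cv′≤u′
... | r , refl | r′ , refl
  with adjacent-convergent N {shift (a 0) C} (λ i → a⁺ (suc i)) (Expands-tail {C} e)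
         {suc v} {r} {v′} {r′} size′
         (Adjacent-step⁻ C (a 0) (suc v , r) (v′ , r′) adj) v≤v′
         (remainder-≤ C {a 0} adj (s≤s z≤n) v≤v′ u≤u′)
  where
  -- Termination: `a 0 ≥ 1` gives suc v + r ≤ a 0 * suc v + r, and the positive denominator `suc v`
  -- drops out of the entry sum.
  size′ : suc v + r ≤ N
  size′ = ≤-pred (≤-trans (s≤s (+-monoˡ-≤ r
    (subst (_≤ a 0 * suc v) (*-identityˡ (suc v)) (*-monoˡ-≤ (suc v) (a⁺ 0)))))
    (≤-trans (≤-trans (≤-reflexive (+-comm 1 _)) (+-monoʳ-≤ _ (s≤s z≤n))) size))
... | n , j , p , q = suc n , j , cong (step (a 0)) p , cong (step (a 0)) q

-- Complete quotients, translations and periods.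

shiftBy : ℕ → (ℕ → ℕ) → Cut → Cut
shiftBy zero    a C = C
shiftBy (suc n) a C = shiftBy n (tail a) (shift (a 0) C)

Expands-drop : ∀ {C a} n → Expands C a → Expands (shiftBy n a C) (drop n a)
Expands-drop     zero    e = e
Expands-drop {C} (suc n) e = Expands-drop n (Expands-tail {C} e)

shiftBy-Above : ∀ n {a C w} →
  Side n (Above C (act a n w)) (Below C (act a n w)) → Above (shiftBy n a C) w
shiftBy-Above zero    (here h)  = h
shiftBy-Above (suc n) (there s) = shiftBy-Above n s

shiftBy-Below : ∀ n {a C w} →
  Side n (Below C (act a n w)) (Above C (act a n w)) → Below (shiftBy n a C) w
shiftBy-Below zero    (here h)  = h
shiftBy-Below (suc n) (there s) = shiftBy-Below n s

-- If `a` expands θ, this expands θ + j.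
translate : ℕ → (ℕ → ℕ) → ℕ → ℕ
translate j a zero    = j + a 0
translate j a (suc i) = a (suc i)

act-translate : ∀ j a k → act (translate j a) k ∞ ≡ comb (proj₁ (act a k ∞)) ∞ (proj₂ (act a k ∞)) (j , 1)
act-translate j a zero    = refl
act-translate j a (suc k) = cong₂ _,_ (lemma₁ j (a 0) _ _) (lemma₂ (proj₁ (act a (suc k) ∞)) _)
  where
  lemma₁ : ∀ j c u v → (j + c) * u + v ≡ (c * u + v) * 1 + u * j
  lemma₁ = solve-∀
  lemma₂ : ∀ p u → u ≡ p * 0 + u * 1
  lemma₂ = solve-∀

-- The term b 0 is exempt: √ expansions are periodic only from b 1 on.

record Period (b : ℕ → ℕ) (n : ℕ) : Set where
  constructor period
  field
    repeats : ∀ i → b (n + suc i) ≡ b (suc i)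

open Period

Period-* : ∀ {b p} → Period b p → ∀ k → Period b (k * p)
Period-* hp zero = period λ _ → refl
Period-* {b} {p} hp (suc k) = period λ i → begin
  b (p + k * p + suc i)       ≡⟨ cong b (+-assoc p (k * p) (suc i)) ⟩
  b (p + (k * p + suc i))     ≡⟨ cong (λ j → b (p + j)) (+-suc (k * p) i) ⟩
  b (p + suc (k * p + i))     ≡⟨ repeats hp (k * p + i) ⟩
  b (suc (k * p + i))         ≡⟨ cong b (+-suc (k * p) i) ⟨
  b (k * p + suc i)           ≡⟨ repeats (Period-* hp k) i ⟩
  b (suc i)                   ∎
  where open ≡-Reasoning

-- Both indices arise from their common multiple (n + 1)(p + 1) by removing whole periods of the
-- other length. This carries the final term 2b₀ of one block to the end of every other period.
Period-last : ∀ {b p n} → Period b (suc p) → Period b (suc n) → b (suc p) ≡ b (suc n)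
Period-last {b} {p} {n} hp hn = begin
  b (suc p)                   ≡⟨ repeats (Period-* hp n) p ⟨
  b (n * suc p + suc p)       ≡⟨ cong b (lemma n p) ⟩
  b (p * suc n + suc n)       ≡⟨ repeats (Period-* hn p) n ⟩
  b (suc n)                   ∎
  where
  open ≡-Reasoning
  lemma : ∀ n p → n * suc p + suc p ≡ p * suc n + suc n
  lemma = solve-∀

Period-∸ : ∀ {b p r} l → Period b p → Period b (r + l * p) → Period b r
Period-∸ {b} {p} {r} l hp hn = period λ i → begin
  b (r + suc i)               ≡⟨ cong b (+-suc r i) ⟩
  b (suc (r + i))             ≡⟨ repeats (Period-* hp l) (r + i) ⟨
  b (l * p + suc (r + i))     ≡⟨ cong b (lemma (l * p) r i) ⟩
  b (r + l * p + suc i)       ≡⟨ repeats hn i ⟩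
  b (suc i)                   ∎
  where
  open ≡-Reasoning
  lemma : ∀ k r i → k + suc (r + i) ≡ r + k + suc i
  lemma = solve-∀

LeastPeriod : (ℕ → ℕ) → ℕ → Set
LeastPeriod b p = ∀ r → Period b (suc r) → p ≤ suc r

least-period-divides : ∀ {b m n} → Period b (suc m) → LeastPeriod b (suc m) →
  Period b n → ∃ λ l → n ≡ l * suc m
least-period-divides {b} {m} {n} hp least hn
  with n % suc m | m%n<n n (suc m) | m≡m%n+[m/n]*n n (suc m)
... | zero  | _   | n≡ = n div suc m , n≡
... | suc r | r<m | n≡ = ⊥-elim (<⇒≱ r<m (least r
  (Period-∸ (n div suc m) hp (subst (Period b) n≡ hn))))

-- The cut of √(D/Q) and solutions of x² - DQy² = ±1.

module _ (D Q : ℕ) where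

  √-cut : Cut
  √-cut = record
    { Above     = λ (u , v) → D * (v * v) < Q * (u * u)
    ; Below     = λ (u , v) → Q * (u * u) < D * (v * v)
    ; separated = λ {w} {w′} → sep w w′
    }
    where
    sep : ∀ w w′ → Q * (proj₁ w * proj₁ w) < D * (proj₂ w * proj₂ w) →
      D * (proj₂ w′ * proj₂ w′) < Q * (proj₁ w′ * proj₁ w′) → w ⊏ w′
    sep (u , zero) _ below _ = ⊥-elim (n≮0 (subst (Q * (u * u) <_) (*-zeroʳ D) below))
    sep (u , v@(suc _)) (u′ , v′) below above = ≰⇒> λ le → <-irrefl refl (begin-strict
      D * (v′ * v′) * (v * v)   <⟨ *-monoˡ-< (v * v) above ⟩
      Q * (u′ * u′) * (v * v)   ≡⟨ regroup Q u′ v ⟩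
      Q * (u′ * v * (u′ * v))   ≤⟨ *-monoʳ-≤ Q (*-mono-≤ le le) ⟩
      Q * (u * v′ * (u * v′))   ≡⟨ regroup Q u v′ ⟨
      Q * (u * u) * (v′ * v′)   ≤⟨ *-monoˡ-≤ (v′ * v′) (<⇒≤ below) ⟩
      D * (v * v) * (v′ * v′)   ≡⟨ swap-squares D v v′ ⟩
      D * (v′ * v′) * (v * v)   ∎)
      where
      open ≤-Reasoning
      regroup : ∀ q a b → q * (a * a) * (b * b) ≡ q * (a * b * (a * b))
      regroup = solve-∀
      swap-squares : ∀ d a b → d * (a * a) * (b * b) ≡ d * (b * b) * (a * a)
      swap-squares = solve-∀

  -- Multiplication by x + y√(DQ) acts on u√Q + v√D by the matrix (x Dy; Qy x).

  mult : ℕ → ℕ → ℕ × ℕ → ℕ × ℕ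
  mult x y (u , v) = comb u (x , Q * y) v (D * y , x)

  private
    transfer-< : ∀ {a b p q} → a + p ≡ b + q → p < q → b < a
    transfer-< {a} {b} {p} {q} eq p<q = +-cancelʳ-< q b a
      (subst (_< a + q) eq (+-monoʳ-< a p<q))

    expand-Q : ∀ D Q x y u v → Q * ((u * x + v * (D * y)) * (u * x + v * (D * y))) ≡
      Q * (u * u) * (x * x) + 2 * (Q * D * u * v * x * y) + D * (v * v) * (D * y * (Q * y))
    expand-Q = solve 6 (λ D Q x y u v →
      Q :* ((u :* x :+ v :* (D :* y)) :* (u :* x :+ v :* (D :* y))) :=
      Q :* (u :* u) :* (x :* x) :+ con 2 :* (Q :* D :* u :* v :* x :* y) :+ D :* (v :* v) :* (D :* y :* (Q :* y)))
      refl
      where open ℕ-Solver.+-*-Solver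

    expand-D : ∀ D Q x y u v → D * ((u * (Q * y) + v * x) * (u * (Q * y) + v * x)) ≡
      Q * (u * u) * (D * y * (Q * y)) + 2 * (Q * D * u * v * x * y) + D * (v * v) * (x * x)
    expand-D = solve 6 (λ D Q x y u v →
      D :* ((u :* (Q :* y) :+ v :* x) :* (u :* (Q :* y) :+ v :* x)) :=
      Q :* (u :* u) :* (D :* y :* (Q :* y)) :+ con 2 :* (Q :* D :* u :* v :* x :* y) :+ D :* (v :* v) :* (x :* x))
      refl
      where open ℕ-Solver.+-*-Solver

    cross₁ : ∀ p q m t → p * suc t + m + q * t + q ≡ p * t + m + q * suc t + p
    cross₁ = solve-∀

    cross₂ : ∀ p q m t → p * t + m + q * suc t + p ≡ p * suc t + m + q * t + q
    cross₂ = solve-∀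

  module _ {x y : ℕ} (norm : (x , Q * y) ⋗ (D * y , x)) (u v : ℕ) where
    private
      -- Multiplicativity of the norm: with (U, V) the image of (u, v), QU² - DV² = (x² - DQy²)(Qu²
      -- - Dv²), here for the factor 1 and with the negative terms moved across.
      identity : Q * (proj₁ (mult x y (u , v)) * proj₁ (mult x y (u , v))) + D * (v * v) ≡
                 D * (proj₂ (mult x y (u , v)) * proj₂ (mult x y (u , v))) + Q * (u * u)
      identity = trans (cong (_+ D * (v * v)) (trans (expand-Q D Q x y u v) (cong (λ n → U * n + M + V * T) norm)))
        (trans (cross₁ U V M T)
        (cong (_+ Q * (u * u)) (sym (trans (expand-D D Q x y u v) (cong (λ n → U * T + M + V * n) norm)))))
        where
        U = Q * (u * u)
        V = D * (v * v)
        M = 2 * (Q * D * u * v * x * y)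
        T = D * y * (Q * y)

    mult⁺-Above : Above √-cut (u , v) → Above √-cut (mult x y (u , v))
    mult⁺-Above = transfer-< identity

    mult⁺-Below : Below √-cut (u , v) → Below √-cut (mult x y (u , v))
    mult⁺-Below = transfer-< (sym identity)

  module _ {x y : ℕ} (norm : (D * y , x) ⋗ (x , Q * y)) (u v : ℕ) where
    private
      -- The same identity for the factor -1, which exchanges the two sides of the cut.
      identity : Q * (proj₁ (mult x y (u , v)) * proj₁ (mult x y (u , v))) + Q * (u * u) ≡
                 D * (proj₂ (mult x y (u , v)) * proj₂ (mult x y (u , v))) + D * (v * v)
      identity = trans (cong (_+ Q * (u * u)) (trans (expand-Q D Q x y u v) (cong (λ n → U * T + M + V * n) norm)))
        (trans (cross₂ U V M T)
        (cong (_+ D * (v * v)) (sym (trans (expand-D D Q x y u v) (cong (λ n → U * n + M + V * T) norm)))))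
        where
        U = Q * (u * u)
        V = D * (v * v)
        M = 2 * (Q * D * u * v * x * y)
        T = x * x

    mult⁻-Above : Above √-cut (u , v) → Below √-cut (mult x y (u , v))
    mult⁻-Above = transfer-< (sym identity)

    mult⁻-Below : Below √-cut (u , v) → Above √-cut (mult x y (u , v))
    mult⁻-Below = transfer-< identity

  -- The equation x² - DQy² = ±1, phrased as the matrix of `mult x y` having determinant ±1.
  IsPellSolution : ℕ → ℕ → Set
  IsPellSolution x y = (x , Q * y) ⋗ (D * y , x) ⊎ (D * y , x) ⋗ (x , Q * y)

  -- Multiplying the norm equation by Q compares x/(Qy) with √(D/Q), and multiplying it by D does
  -- the same for Dy/x.
  pell-adjacent : ∀ {x y} .{{_ : NonZero D}} .{{_ : NonZero Q}} → IsPellSolution x y →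
    Adjacent √-cut (x , Q * y) (D * y , x)
  pell-adjacent {x} {y} (inj₁ norm) = inj₁ (norm ,
    subst₂ _<_ (e₁ D Q y) (cong (Q *_) (sym norm)) (*-monoʳ-< Q ≤-refl) ,
    subst₂ _<_ (e₂ D Q y) (cong (D *_) (sym norm)) (*-monoʳ-< D ≤-refl))
    where
    e₁ : ∀ D Q y → Q * (D * y * (Q * y)) ≡ D * (Q * y * (Q * y))
    e₁ = solve-∀
    e₂ : ∀ D Q y → D * (D * y * (Q * y)) ≡ Q * (D * y * (D * y))
    e₂ = solve-∀
  pell-adjacent {x} {y} (inj₂ norm) = inj₂ (norm ,
    subst (D * (x * x) <_) (trans (cong (D *_) (sym norm)) (e₁ D Q y)) (*-monoʳ-< D ≤-refl) ,
    subst (Q * (x * x) <_) (trans (cong (Q *_) (sym norm)) (e₂ D Q y)) (*-monoʳ-< Q ≤-refl))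
    where
    e₁ : ∀ D Q y → D * (D * y * (Q * y)) ≡ Q * (D * y * (D * y))
    e₁ = solve-∀
    e₂ : ∀ D Q y → Q * (D * y * (Q * y)) ≡ D * (Q * y * (Q * y))
    e₂ = solve-∀

-- If x < s, then ts ≥ (x + 2)(x + 1) exceeds x² + 1; if x > t, then x² ≥ (t + 1)² exceeds ts + 1.
between : ∀ {s t x} → s < t → x * x ≤ suc (t * s) → t * s ≤ suc (x * x) → s ≤ x × x ≤ t
between {s} {t} {x} s<t x²≤ts ts≤x² = ≮⇒≥ x≮s , ≮⇒≥ t≮x
  where
  open ≤-Reasoning
  x≮s : x < s → ⊥
  x≮s x<s = <-irrefl refl (begin-strict
    x * x                       <⟨ ≤-reflexive (+-comm 1 (x * x)) ⟩
    x * x + 1                   ≤⟨ m≤m+n _ (3 * x) ⟩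
    x * x + 1 + 3 * x           ≡⟨ lemma x ⟩
    pred (suc (suc x) * suc x)  ≤⟨ pred-mono-≤ (*-mono-≤ (≤-trans (s≤s x<s) s<t) x<s) ⟩
    pred (t * s)                ≤⟨ pred-mono-≤ ts≤x² ⟩
    x * x                       ∎)
    where
    lemma′ : ∀ x → suc (x * x + 1 + 3 * x) ≡ suc (suc x) * suc x
    lemma′ = solve-∀
    lemma : ∀ x → x * x + 1 + 3 * x ≡ pred (suc (suc x) * suc x)
    lemma x = cong pred (lemma′ x)
  t≮x : t < x → ⊥
  t≮x t<x = <-irrefl refl (begin-strict
    suc (t * s)                 ≤⟨ s≤s (*-monoʳ-≤ t (<⇒≤ s<t)) ⟩
    suc (t * t)                 <⟨ s≤s (m<n+m (t * t) (≤-<-trans z≤n s<t)) ⟩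
    suc (t + t * t)             ≡⟨ cong suc (*-suc t t) ⟨
    suc (t * suc t)             ≤⟨ s≤s (m≤n+m (t * suc t) t) ⟩
    suc t * suc t               ≤⟨ *-mono-≤ t<x t<x ⟩
    x * x                       ≤⟨ x²≤ts ⟩
    suc (t * s)                 ∎)

module _ {D Q : ℕ} .{{_ : NonZero D}} .{{_ : NonZero Q}} where

  -- Here D/Q > 1 orders the columns (x, Qy) and (Dy, x) in the way `adjacent-convergent` demands.
  IsPellSolution-between : ∀ {x y} .{{_ : NonZero y}} → Q < D → IsPellSolution D Q x y →
    Q * y ≤ x × x ≤ D * y
  IsPellSolution-between {x} {y} Q<D (inj₁ norm) = between (*-monoˡ-< y Q<D)
    (≤-reflexive norm) (≤-trans (n≤1+n _) (≤-trans (≤-reflexive (sym norm)) (n≤1+n _)))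
  IsPellSolution-between {x} {y} Q<D (inj₂ norm) = between (*-monoˡ-< y Q<D)
    (≤-trans (n≤1+n _) (≤-trans (≤-reflexive (sym norm)) (n≤1+n _))) (≤-reflexive norm)

  module _ {b : ℕ → ℕ} (b⁺ : Positive b) (e : Expands (√-cut D Q) b) where

    -- The matrix preserves or exchanges the sides of the cut according to the parity of `n`,
    -- exactly as `n` steps do. Stripping those steps shows that the n-th complete quotient is
    -- √(D/Q) + j.
    pell-translate : ∀ {x y} n j → (x , Q * y) ≡ act b n ∞ → (D * y , x) ≡ act b n (j , 1) →
      Expands (shiftBy n b (√-cut D Q)) (translate j b)
    pell-translate {x} {y} n j p q k rewrite act-translate j b k =
      Side-map
        (λ above → shiftBy-Above n (subst (λ w → Side n (Above C w) (Below C w)) (sym (image u v))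
          (Side-map (λ norm → mult⁺-Above D Q {x} {y} norm u v above)
                    (λ norm → mult⁻-Above D Q {x} {y} norm u v above) norms)))
        (λ below → shiftBy-Below n (subst (λ w → Side n (Below C w) (Above C w)) (sym (image u v))
          (Side-map (λ norm → mult⁺-Below D Q {x} {y} norm u v below)
                    (λ norm → mult⁻-Below D Q {x} {y} norm u v below) norms)))
        (e k)
      where
      C = √-cut D Q
      u = proj₁ (act b k ∞)
      v = proj₂ (act b k ∞)
      image : ∀ u v → act b n (comb u ∞ v (j , 1)) ≡ mult D Q x y (u , v)
      image u v = trans (act-comb b n u ∞ v (j , 1))
        (cong₂ (λ w w′ → comb u w v w′) (sym p) (sym q))
      norms : Side n ((x , Q * y) ⋗ (D * y , x)) ((D * y , x) ⋗ (x , Q * y))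
      norms = subst₂ (λ w w′ → Side n (w ⋗ w′) (w′ ⋗ w)) (sym p) (sym q) (act-⋗ b n {∞} {j , 1} (∞⋗ j))

    -- One complete quotient has two expansions, the rest of `b` and `translate j b`; uniqueness
    -- identifies them, and their terms after the first give the period.
    pell-period : ∀ {x y} .{{_ : NonZero y}} → Q < D → IsPellSolution D Q x y →
      ∃ λ n → Period b (suc n) × (x , Q * y) ≡ act b (suc n) ∞
    pell-period {x} {y} Q<D norm with IsPellSolution-between {x} {y} Q<D norm
    ... | s≤x , x≤t with adjacent-convergent _ {√-cut D Q} b⁺ e {x} {Q * y} {D * y} {x} ≤-refl
                           (pell-adjacent D Q {x} {y} norm) x≤t s≤x
    -- Without factors the first column would be 1/0, but `Q * y` is positive.
    ... | zero  , j , p , q = ⊥-elim (<-irrefl (sym (cong proj₂ p)) (>-nonZero⁻¹ (Q * y) {{m*n≢0 Q y}}))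
    ... | suc n , j , p , q = n , period (λ i → sym (expansion-unique {shiftBy (suc n) b (√-cut D Q)}
            translate⁺ (λ i → b⁺ (suc n + i))
            (pell-translate {x} {y} (suc n) j p q) (Expands-drop {√-cut D Q} {b} (suc n) e) (suc i))) , p
      where
      translate⁺ : Positive (translate j b)
      translate⁺ zero    = ≤-trans (b⁺ 0) (m≤n+m (b 0) j)
      translate⁺ (suc i) = b⁺ (suc i)

    pell-end-of-period : ∀ {m x y} .{{_ : NonZero y}} → Period b (suc m) → LeastPeriod b (suc m) →
      Q < D → IsPellSolution D Q x y → ∃ λ l → (x , Q * y) ≡ act b (suc l * suc m) ∞
    pell-end-of-period {m} {x} {y} hm least Q<D norm with pell-period {x} {y} Q<D norm
    ... | n , hn , eq with least-period-divides {b} hm least hn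
    ... | suc l , n≡ = l , trans eq (cong (λ k → act b k ∞) n≡)

-- Strict comparisons and growth of numerators and denominators.

step-⊏ : ∀ c w w′ → w ⊏ w′ → step c w′ ⊏ step c w
step-⊏ c (u , v) (u′ , v′) h = subst₂ _<_ (sym (step-cross c u v u′ v′)) (sym (step-cross′ c u v u′ v′))
  (+-monoʳ-< (c * (u * u′)) h)

act-⊏ : ∀ a n {w w′} → w ⊏ w′ → Side n (act a n w ⊏ act a n w′) (act a n w′ ⊏ act a n w)
act-⊏ a zero    h = here h
act-⊏ a (suc n) {w} {w′} h = there (Side-map
  (step-⊏ (a 0) (act (tail a) n w) (act (tail a) n w′))
  (step-⊏ (a 0) (act (tail a) n w′) (act (tail a) n w))
  (act-⊏ (tail a) n h))

-- Linear growth is enough to outrun the constant bound on the quadratic forms. The conjunct `1 ≤`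
-- supplies the increment, which `n ≤` alone does not at n = 0.
numerator-≥ : ∀ {a} → Positive a → ∀ n → n ≤ proj₁ (act a n ∞) × 1 ≤ proj₁ (act a n ∞)
numerator-≥ {a} a⁺ zero    = z≤n , s≤s z≤n
numerator-≥ {a} a⁺ (suc zero) = h , h
  where
  h : 1 ≤ a 0 * 1 + 0
  h = ≤-trans (*-mono-≤ (a⁺ 0) (≤-refl {1})) (m≤m+n _ 0)
numerator-≥ {a} a⁺ (suc (suc n)) =
  grow (a⁺ 0) (numerator-≥ {tail a} (λ i → a⁺ (suc i)) (suc n))
              (numerator-≥ {tail (tail a)} (λ i → a⁺ (suc (suc i))) n)
  where
  grow : ∀ {c u v} → 1 ≤ c → suc n ≤ u × 1 ≤ u → n ≤ v × 1 ≤ v →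
    suc (suc n) ≤ c * u + v × 1 ≤ c * u + v
  grow {c} {u} {v} 1≤c (n<u , 1≤u) (_ , 1≤v) =
    ≤-trans (≤-reflexive (+-comm 1 (suc n)))
      (+-mono-≤ (≤-trans n<u (≤-trans (≤-reflexive (sym (*-identityˡ u))) (*-monoˡ-≤ u 1≤c))) 1≤v) ,
    ≤-trans 1≤v (m≤n+m v (c * u))

denominator-≥ : ∀ {a} → Positive a → ∀ n → n ≤ proj₂ (act a (suc n) ∞) × 1 ≤ proj₂ (act a (suc n) ∞)
denominator-≥ {a} a⁺ n = numerator-≥ {tail a} (λ i → a⁺ (suc i)) n

-- Binary quadratic forms along the convergents.

pos-difference : ∀ {m n} → m < n → ∃ λ e → + n ℤ.- + m ≡ +[1+ e ]
pos-difference {m} m<n with m≤n⇒∃[o]m+o≡n m<n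
... | e , refl = e , solve 2 (λ m e → con 1ℤ :+ m :+ e :- m := con 1ℤ :+ e) refl (+ m) (+ e)
  where open ℤ-Solver.+-*-Solver

neg-difference : ∀ {m n} → m < n → ∃ λ e → + m ℤ.- + n ≡ -[1+ e ]
neg-difference {m} {n} m<n with pos-difference m<n
... | e , eq = e , trans (solve 2 (λ m n → m :- n := :- (n :- m)) refl (+ m) (+ n)) (cong ℤ.-_ eq)
  where open ℤ-Solver.+-*-Solver

form : ℤ → ℤ → ℤ → ℤ → ℤ → ℤ
form A B C u v = A ℤ.* (u ℤ.* u) ℤ.+ B ℤ.* (u ℤ.* v) ℤ.+ C ℤ.* (v ℤ.* v)

disc : ℤ → ℤ → ℤ → ℤ
disc A B C = B ℤ.* B ℤ.- + 4 ℤ.* (A ℤ.* C)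

polar : ℤ → ℤ → ℤ → ℤ → ℤ → ℤ → ℤ → ℤ
polar A B C u v u′ v′ =
  + 2 ℤ.* (A ℤ.* (u ℤ.* u′)) ℤ.+ B ℤ.* (u ℤ.* v′ ℤ.+ u′ ℤ.* v) ℤ.+ + 2 ℤ.* (C ℤ.* (v ℤ.* v′))

-- In the basis w, w′ the form has coefficients f(w), P, f(w′), and a change of basis multiplies the
-- discriminant by the square of its determinant d.
polar-identity : ∀ A B C u v u′ v′ → let d = u ℤ.* v′ ℤ.- u′ ℤ.* v; P = polar A B C u v u′ v′ in
  disc A B C ℤ.* (d ℤ.* d) ≡ P ℤ.* P ℤ.- + 4 ℤ.* (form A B C u v ℤ.* form A B C u′ v′)
polar-identity = solve 7 (λ A B C u v u′ v′ →
  (B :* B :- con (+ 4) :* (A :* C)) :* ((u :* v′ :- u′ :* v) :* (u :* v′ :- u′ :* v)) :=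
  (con (+ 2) :* (A :* (u :* u′)) :+ B :* (u :* v′ :+ u′ :* v) :+ con (+ 2) :* (C :* (v :* v′))) :*
  (con (+ 2) :* (A :* (u :* u′)) :+ B :* (u :* v′ :+ u′ :* v) :+ con (+ 2) :* (C :* (v :* v′))) :-
  con (+ 4) :* ((A :* (u :* u) :+ B :* (u :* v) :+ C :* (v :* v)) :*
                (A :* (u′ :* u′) :+ B :* (u′ :* v′) :+ C :* (v′ :* v′)))) refl
  where open ℤ-Solver.+-*-Solver

data IsPos : ℤ → Set where
  pos : ∀ e → IsPos +[1+ e ]
data IsNeg : ℤ → Set where
  neg : ∀ e → IsNeg -[1+ e ]

Opposite : ℤ → ℤ → Set
Opposite i j = IsPos i × IsNeg j ⊎ IsNeg i × IsPos j

square-nonneg : ∀ i → i ℤ.* i ≡ + (ℤ.∣ i ∣ * ℤ.∣ i ∣)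
square-nonneg (+ n)    = sym (ℤₚ.pos-* n n)
square-nonneg -[1+ n ] = refl

opposite-product : ∀ {i j} → Opposite i j → i ℤ.* j ≡ ℤ.- + (ℤ.∣ i ∣ * ℤ.∣ j ∣) × ℤ.∣ i ∣ ≤ ℤ.∣ i ∣ * ℤ.∣ j ∣
opposite-product (inj₁ (pos e , neg e′)) = refl , m≤m*n (suc e) (suc e′)
opposite-product (inj₂ (neg e , pos e′)) = refl , m≤m*n (suc e) (suc e′)

unit-square : ∀ u v u′ v′ → (u , v) ⋗ (u′ , v′) ⊎ (u′ , v′) ⋗ (u , v) →
  let d = + u ℤ.* + v′ ℤ.- + u′ ℤ.* + v in d ℤ.* d ≡ 1ℤ
unit-square u v u′ v′ (inj₁ h)
  rewrite sym (ℤₚ.pos-* u v′) | sym (ℤₚ.pos-* u′ v) | h =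
  solve 1 (λ x → (con 1ℤ :+ x :- x) :* (con 1ℤ :+ x :- x) := con 1ℤ) refl (+ (u′ * v))
  where open ℤ-Solver.+-*-Solver
unit-square u v u′ v′ (inj₂ h)
  rewrite sym (ℤₚ.pos-* u v′) | sym (ℤₚ.pos-* u′ v) | h =
  solve 1 (λ x → (x :- (con 1ℤ :+ x)) :* (x :- (con 1ℤ :+ x)) := con 1ℤ) refl (+ (u * v′))
  where open ℤ-Solver.+-*-Solver

-- Determinant ±1 and opposite signs turn the discriminant into P² + 4|f(w)||f(w′)|, and |f(w′)| ≥
-- 1.
form-bound : ∀ A B C u v u′ v′ → (u , v) ⋗ (u′ , v′) ⊎ (u′ , v′) ⋗ (u , v) →
  Opposite (form A B C (+ u) (+ v)) (form A B C (+ u′) (+ v′)) →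
  ℤ.∣ form A B C (+ u) (+ v) ∣ ≤ ℤ.∣ disc A B C ∣
form-bound A B C u v u′ v′ det opp = let open ≤-Reasoning in begin
  ℤ.∣ i ∣                                   ≤⟨ proj₂ (opposite-product opp) ⟩
  ℤ.∣ i ∣ * ℤ.∣ j ∣                         ≤⟨ m≤n*m (ℤ.∣ i ∣ * ℤ.∣ j ∣) 4 ⟩
  4 * (ℤ.∣ i ∣ * ℤ.∣ j ∣)                   ≤⟨ m≤n+m _ (ℤ.∣ P ∣ * ℤ.∣ P ∣) ⟩
  ℤ.∣ P ∣ * ℤ.∣ P ∣ + 4 * (ℤ.∣ i ∣ * ℤ.∣ j ∣) ≡⟨ cong ℤ.∣_∣ disc≡ ⟨
  ℤ.∣ disc A B C ∣                          ∎
  where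
  i = form A B C (+ u) (+ v)
  j = form A B C (+ u′) (+ v′)
  P = polar A B C (+ u) (+ v) (+ u′) (+ v′)
  d = + u ℤ.* + v′ ℤ.- + u′ ℤ.* + v
  disc≡ : disc A B C ≡ + (ℤ.∣ P ∣ * ℤ.∣ P ∣ + 4 * (ℤ.∣ i ∣ * ℤ.∣ j ∣))
  disc≡ = let open ≡-Reasoning in begin
    disc A B C                        ≡⟨ ℤₚ.*-identityʳ _ ⟨
    disc A B C ℤ.* 1ℤ                 ≡⟨ cong (disc A B C ℤ.*_) (unit-square u v u′ v′ det) ⟨
    disc A B C ℤ.* (d ℤ.* d)          ≡⟨ polar-identity A B C (+ u) (+ v) (+ u′) (+ v′) ⟩
    P ℤ.* P ℤ.- + 4 ℤ.* (i ℤ.* j)     ≡⟨ cong₂ (λ x y → x ℤ.- + 4 ℤ.* y)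
                                           (square-nonneg P) (proj₁ (opposite-product opp)) ⟩
    + (ℤ.∣ P ∣ * ℤ.∣ P ∣) ℤ.- + 4 ℤ.* (ℤ.- + (ℤ.∣ i ∣ * ℤ.∣ j ∣))
                                      ≡⟨ solve 2 (λ x y → x :- con (+ 4) :* (:- y) := x :+ con (+ 4) :* y)
                                           refl (+ (ℤ.∣ P ∣ * ℤ.∣ P ∣)) (+ (ℤ.∣ i ∣ * ℤ.∣ j ∣)) ⟩
    + (ℤ.∣ P ∣ * ℤ.∣ P ∣) ℤ.+ + 4 ℤ.* + (ℤ.∣ i ∣ * ℤ.∣ j ∣)
                                      ≡⟨ cong (λ x → + (ℤ.∣ P ∣ * ℤ.∣ P ∣) ℤ.+ x) (ℤₚ.pos-* 4 (ℤ.∣ i ∣ * ℤ.∣ j ∣)) ⟨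
    + (ℤ.∣ P ∣ * ℤ.∣ P ∣ + 4 * (ℤ.∣ i ∣ * ℤ.∣ j ∣)) ∎
    where open ℤ-Solver.+-*-Solver

Alternates : ℤ → ℤ → ℤ → (ℕ → ℕ) → Set₁
Alternates A B C b = ∀ k → let (u , v) = act b k ∞ in
  Side k (IsPos (form A B C (+ u) (+ v))) (IsNeg (form A B C (+ u) (+ v)))

-- Both are images under `act b k`, of 1/0 and of b k/1, which have determinant 1.
consecutive : ∀ b k → act b k ∞ ⋗ act b (suc k) ∞ ⊎ act b (suc k) ∞ ⋗ act b k ∞
consecutive b k = Side-join (Side-map inj₁ inj₂
  (subst (λ w → Side k (act b k ∞ ⋗ w) (w ⋗ act b k ∞))
    (trans (sym (act-+ b k 1 ∞)) (cong (λ i → act b i ∞) (+-comm k 1)))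
    (act-⋗ b k {∞} {b (k + 0) * 1 + 0 , 1} (∞⋗ (b (k + 0) * 1 + 0)))))

Alternates-bound : ∀ A B C {b} → Alternates A B C b → ∀ k → let (u , v) = act b k ∞ in
  ℤ.∣ form A B C (+ u) (+ v) ∣ ≤ ℤ.∣ disc A B C ∣
Alternates-bound A B C {b} alt k with alt (suc k)
... | there s = form-bound A B C (proj₁ w) (proj₂ w) (proj₁ w′) (proj₂ w′) (consecutive b k)
  (Side-join (Side-map inj₁ inj₂ (Side-zip _,_ _,_ (alt k) s)))
  where
  w = act b k ∞
  w′ = act b (suc k) ∞

eliminate : ∀ A B C A′ B′ C′ u v → A′ ℤ.* form A B C u v ℤ.- A ℤ.* form A′ B′ C′ u v ≡
  v ℤ.* ((A′ ℤ.* B ℤ.- A ℤ.* B′) ℤ.* u ℤ.+ (A′ ℤ.* C ℤ.- A ℤ.* C′) ℤ.* v)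
eliminate = solve 8 (λ A B C A′ B′ C′ u v →
  A′ :* (A :* (u :* u) :+ B :* (u :* v) :+ C :* (v :* v)) :-
  A :* (A′ :* (u :* u) :+ B′ :* (u :* v) :+ C′ :* (v :* v)) :=
  v :* ((A′ :* B :- A :* B′) :* u :+ (A′ :* C :- A :* C′) :* v)) refl
  where open ℤ-Solver.+-*-Solver

-- Eliminating u² leaves v times a linear form; since both quadratic forms stay bounded
-- while v → ∞, the linear form vanishes at two independent vectors.

alternating-forms-proportional : ∀ A B C A′ B′ C′ {b} → Positive b →
  Alternates A B C b → Alternates A′ B′ C′ b →
  A′ ℤ.* B ≡ A ℤ.* B′ × A′ ℤ.* C ≡ A ℤ.* C′
alternating-forms-proportional A B C A′ B′ C′ {b} b⁺ alt alt′ =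
  ℤₚ.i-j≡0⇒i≡j _ _ κ≡0 , ℤₚ.i-j≡0⇒i≡j _ _ μ≡0
  where
  bound = ℤ.∣ A′ ∣ * ℤ.∣ disc A B C ∣ + ℤ.∣ A ∣ * ℤ.∣ disc A′ B′ C′ ∣
  κ = A′ ℤ.* B ℤ.- A ℤ.* B′
  μ = A′ ℤ.* C ℤ.- A ℤ.* C′

  vanishes : ∀ k → bound < k → let (u , v) = act b (suc k) ∞ in κ ℤ.* + u ℤ.+ μ ℤ.* + v ≡ 0ℤ
  vanishes k bound<k = ℤₚ.∣i∣≡0⇒i≡0 (n<1⇒n≡0 (≰⇒> λ 1≤L → <-irrefl refl (begin-strict
    bound                         <⟨ bound<k ⟩
    k                             ≤⟨ proj₁ (denominator-≥ b⁺ k) ⟩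
    v                             ≡⟨ *-identityʳ v ⟨
    v * 1                         ≤⟨ *-monoʳ-≤ v 1≤L ⟩
    v * ℤ.∣ L ∣                   ≡⟨ ℤₚ.abs-* (+ v) L ⟨
    ℤ.∣ + v ℤ.* L ∣               ≡⟨ cong ℤ.∣_∣ (eliminate A B C A′ B′ C′ (+ u) (+ v)) ⟨
    ℤ.∣ A′ ℤ.* f ℤ.- A ℤ.* g ∣    ≤⟨ ℤₚ.∣i-j∣≤∣i∣+∣j∣ (A′ ℤ.* f) (A ℤ.* g) ⟩
    ℤ.∣ A′ ℤ.* f ∣ + ℤ.∣ A ℤ.* g ∣ ≡⟨ cong₂ _+_ (ℤₚ.abs-* A′ f) (ℤₚ.abs-* A g) ⟩
    ℤ.∣ A′ ∣ * ℤ.∣ f ∣ + ℤ.∣ A ∣ * ℤ.∣ g ∣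
      ≤⟨ +-mono-≤ (*-monoʳ-≤ ℤ.∣ A′ ∣ (Alternates-bound A B C {b} alt (suc k)))
                  (*-monoʳ-≤ ℤ.∣ A ∣ (Alternates-bound A′ B′ C′ {b} alt′ (suc k))) ⟩
    bound                         ∎)))
    where
    open ≤-Reasoning
    u = proj₁ (act b (suc k) ∞)
    v = proj₂ (act b (suc k) ∞)
    L = κ ℤ.* + u ℤ.+ μ ℤ.* + v
    f = form A B C (+ u) (+ v)
    g = form A′ B′ C′ (+ u) (+ v)

  K = suc bound
  w = act b (suc K) ∞
  w′ = act b (suc (suc K)) ∞
  u = + proj₁ w
  v = + proj₂ w
  u′ = + proj₁ w′
  v′ = + proj₂ w′
  L≡0 : κ ℤ.* u ℤ.+ μ ℤ.* v ≡ 0ℤ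
  L≡0 = vanishes K ≤-refl
  L′≡0 : κ ℤ.* u′ ℤ.+ μ ℤ.* v′ ≡ 0ℤ
  L′≡0 = vanishes (suc K) (n≤1+n _)
  d = u ℤ.* v′ ℤ.- u′ ℤ.* v

  -- Cramer's rule, with s and t from the adjugate; d² = 1 lets multiplication by d replace
  -- division.
  cramer : ∀ x s t → d ℤ.* x ≡ s ℤ.* (κ ℤ.* u ℤ.+ μ ℤ.* v) ℤ.+ t ℤ.* (κ ℤ.* u′ ℤ.+ μ ℤ.* v′) → x ≡ 0ℤ
  cramer x s t dx≡ = begin
    x                       ≡⟨ ℤₚ.*-identityˡ x ⟨
    1ℤ ℤ.* x                ≡⟨ cong (ℤ._* x)
                                 (unit-square (proj₁ w) (proj₂ w) (proj₁ w′) (proj₂ w′) (consecutive b (suc K))) ⟨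
    d ℤ.* d ℤ.* x           ≡⟨ ℤₚ.*-assoc d d x ⟩
    d ℤ.* (d ℤ.* x)         ≡⟨ cong (d ℤ.*_) dx≡ ⟩
    d ℤ.* (s ℤ.* (κ ℤ.* u ℤ.+ μ ℤ.* v) ℤ.+ t ℤ.* (κ ℤ.* u′ ℤ.+ μ ℤ.* v′))
                            ≡⟨ cong₂ (λ x y → d ℤ.* (s ℤ.* x ℤ.+ t ℤ.* y)) L≡0 L′≡0 ⟩
    d ℤ.* (s ℤ.* 0ℤ ℤ.+ t ℤ.* 0ℤ)
                            ≡⟨ solve 3 (λ d s t → d :* (s :* con 0ℤ :+ t :* con 0ℤ) := con 0ℤ) refl d s t ⟩
    0ℤ                      ∎
    where
    open ≡-Reasoning
    open ℤ-Solver.+-*-Solver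

  κ≡0 : κ ≡ 0ℤ
  κ≡0 = cramer κ v′ (ℤ.- v) (solve 6 (λ κ μ u v u′ v′ →
    (u :* v′ :- u′ :* v) :* κ := v′ :* (κ :* u :+ μ :* v) :+ (:- v) :* (κ :* u′ :+ μ :* v′)) refl κ μ u v u′ v′)
    where open ℤ-Solver.+-*-Solver

  μ≡0 : μ ≡ 0ℤ
  μ≡0 = cramer μ (ℤ.- u′) u (solve 6 (λ κ μ u v u′ v′ →
    (u :* v′ :- u′ :* v) :* μ := (:- u′) :* (κ :* u :+ μ :* v) :+ u :* (κ :* u′ :+ μ :* v′)) refl κ μ u v u′ v′)
    where open ℤ-Solver.+-*-Solver

IsPos-difference : ∀ {m n i} → i ≡ + n ℤ.- + m → m < n → IsPos i
IsPos-difference i≡ m<n with pos-difference m<n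
... | e , eq = subst IsPos (sym (trans i≡ eq)) (pos e)

IsNeg-difference : ∀ {m n i} → i ≡ + m ℤ.- + n → m < n → IsNeg i
IsNeg-difference i≡ m<n with neg-difference m<n
... | e , eq = subst IsNeg (sym (trans i≡ eq)) (neg e)

√-form : ∀ D Q u v → form (+ Q) 0ℤ (ℤ.- + D) (+ u) (+ v) ≡ + (Q * (u * u)) ℤ.- + (D * (v * v))
√-form D Q u v = trans
  (solve 4 (λ D Q u v → Q :* (u :* u) :+ con 0ℤ :* (u :* v) :+ (:- D) :* (v :* v) :=
    Q :* (u :* u) :- D :* (v :* v)) refl (+ D) (+ Q) (+ u) (+ v))
  (sym (cong₂ ℤ._-_ (pos-*-square Q u) (pos-*-square D v)))
  where
  open ℤ-Solver.+-*-Solver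
  pos-*-square : ∀ a c → + (a * (c * c)) ≡ + a ℤ.* (+ c ℤ.* + c)
  pos-*-square a c = trans (ℤₚ.pos-* a (c * c)) (cong (+ a ℤ.*_) (ℤₚ.pos-* c c))

-- The form whose roots are the fixed points of the matrix (α β; γ δ).

fixed-point-form : ∀ α β γ δ u v →
  form (+ γ) (+ δ ℤ.- + α) (ℤ.- + β) (+ u) (+ v) ≡ + (u * (u * γ + v * δ)) ℤ.- + ((u * α + v * β) * v)
fixed-point-form α β γ δ u v = trans
  (solve 6 (λ α β γ δ u v →
    γ :* (u :* u) :+ (δ :- α) :* (u :* v) :+ (:- β) :* (v :* v) :=
    u :* (u :* γ :+ v :* δ) :- (u :* α :+ v :* β) :* v) refl (+ α) (+ β) (+ γ) (+ δ) (+ u) (+ v))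
  (sym (cong₂ ℤ._-_
    (trans (ℤₚ.pos-* u (u * γ + v * δ)) (cong (+ u ℤ.*_) (pos-comb γ δ)))
    (trans (ℤₚ.pos-* (u * α + v * β) v) (cong (ℤ._* + v) (pos-comb α β)))))
  where
  open ℤ-Solver.+-*-Solver
  pos-comb : ∀ x y → + (u * x + v * y) ≡ + u ℤ.* + x ℤ.+ + v ℤ.* + y
  pos-comb x y = cong₂ ℤ._+_ (ℤₚ.pos-* u x) (ℤₚ.pos-* v y)

Expands⇒Alternates : ∀ {D Q b} → Expands (√-cut D Q) b → Alternates (+ Q) 0ℤ (ℤ.- + D) b
Expands⇒Alternates {D} {Q} {b} e k = Side-map
  (IsPos-difference (√-form D Q u v)) (IsNeg-difference (√-form D Q u v)) (e k)
  where
  u = proj₁ (act b k ∞)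
  v = proj₂ (act b k ∞)

-- From a period to a solution of x² - DQy² = ±1.

module _ {b : ℕ → ℕ} (b⁺ : Positive b) {n : ℕ} (hn : Period b (suc n))
  (last : b (suc n) ≡ b 0 + b 0) where
  private
    N = suc n
    α = proj₁ (act b N ∞)
    γ = proj₂ (act b N ∞)
    β = proj₁ (act b N (b 0 , 1))
    δ = proj₂ (act b N (b 0 , 1))

  -- The hypothesis `last` settles index 0, which `Period` leaves open: what follows a period is `b`
  -- with `b 0` added to its first term.
  drop-period : ∀ i → drop N b i ≡ translate (b 0) b i
  drop-period zero    = trans (cong b (+-identityʳ N)) last
  drop-period (suc i) = Period.repeats hn i

  -- The matrix (α β; γ δ), the first N factors followed by the translation by `b 0`, advances every
  -- convergent by a full period.
  act-period : ∀ k → act b (k + N) ∞ ≡ comb (proj₁ (act b k ∞)) (α , γ) (proj₂ (act b k ∞)) (β , δ)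
  act-period k = begin
    act b (k + N) ∞                         ≡⟨ cong (λ i → act b i ∞) (+-comm k N) ⟩
    act b (N + k) ∞                         ≡⟨ act-+ b N k ∞ ⟩
    act b N (act (drop N b) k ∞)            ≡⟨ cong (act b N) (act-cong drop-period k ∞) ⟩
    act b N (act (translate (b 0) b) k ∞)   ≡⟨ cong (act b N) (act-translate (b 0) b k) ⟩
    act b N (comb u ∞ v (b 0 , 1))          ≡⟨ act-comb b N u ∞ v (b 0 , 1) ⟩
    comb u (α , γ) v (β , δ)                ∎
    where
    open ≡-Reasoning
    u = proj₁ (act b k ∞)
    v = proj₂ (act b k ∞)

  -- The form at w is the cross-multiplied difference between w and its image, and the image of a
  -- convergent is the convergent N terms later. `act b k` transports `below-∞` to these two, so the
  -- sign depends only on the parity of `k` and no limit is taken.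
  period-Alternates : Alternates (+ γ) (+ δ ℤ.- + α) (ℤ.- + β) b
  period-Alternates k = Side-map
    (IsPos-difference (fixed-point-form α β γ δ u v))
    (IsNeg-difference (fixed-point-form α β γ δ u v))
    (subst (λ w → Side k (w ⊏ (u , v)) ((u , v) ⊏ w)) (trans (sym (act-+ b k N ∞)) (act-period k))
      (act-⊏ b k {act (drop k b) N ∞} {∞} below-∞))
    where
    u = proj₁ (act b k ∞)
    v = proj₂ (act b k ∞)
    below-∞ : act (drop k b) N ∞ ⊏ ∞
    below-∞ = subst₂ _<_ (sym (*-zeroʳ (proj₁ (act (drop k b) N ∞)))) (sym (*-identityˡ _))
      (proj₂ (denominator-≥ {drop k b} (λ i → b⁺ (k + i)) n))

  -- Proportionality to Qu² - Dv² gives α = δ and Dγ = Qβ. Coprimality then gives γ = Qy, hence β =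
  -- Dy, and the determinant ±1 of the matrix is the norm equation.
  period-unit : ∀ {D Q} .{{_ : NonZero Q}} → Coprime D Q → Expands (√-cut D Q) b →
    ∃ λ y → γ ≡ Q * y × 1 ≤ y × IsPellSolution D Q α y
  period-unit {D} {Q} D⊥Q e =
    quotient-solution (coprime-divisor (Coprimality.sym D⊥Q) (divides β (trans Dγ≡Qβ (*-comm Q β))))
    where
    proportional : + Q ℤ.* (+ δ ℤ.- + α) ≡ + γ ℤ.* 0ℤ × + Q ℤ.* (ℤ.- + β) ≡ + γ ℤ.* (ℤ.- + D)
    proportional = alternating-forms-proportional
      (+ γ) (+ δ ℤ.- + α) (ℤ.- + β) (+ Q) 0ℤ (ℤ.- + D) b⁺ period-Alternates (Expands⇒Alternates {D} {Q} {b} e)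
    α≡δ : α ≡ δ
    α≡δ = sym (ℤₚ.+-injective (ℤₚ.i-j≡0⇒i≡j (+ δ) (+ α) (ℤₚ.*-cancelˡ-≡ (+ Q) _ 0ℤ
      (trans (proj₁ proportional) (trans (ℤₚ.*-zeroʳ (+ γ)) (sym (ℤₚ.*-zeroʳ (+ Q))))))))
    Dγ≡Qβ : D * γ ≡ Q * β
    Dγ≡Qβ = trans (*-comm D γ) (sym (ℤₚ.+-injective (trans (ℤₚ.pos-* Q β) (trans
      (ℤₚ.neg-injective (trans (ℤₚ.neg-distribʳ-* (+ Q) (+ β))
        (trans (proj₂ proportional) (sym (ℤₚ.neg-distribʳ-* (+ γ) (+ D))))))
      (sym (ℤₚ.pos-* γ D))))))
    quotient-solution : Q ∣ γ → ∃ λ y → γ ≡ Q * y × 1 ≤ y × IsPellSolution D Q α y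
    quotient-solution (divides y γ≡yQ) = y , γ≡Qy ,
      n≢0⇒n>0 (λ y≡0 → <-irrefl (sym (trans γ≡yQ (cong (_* Q) y≡0))) (proj₂ (denominator-≥ b⁺ n))) ,
      Side-join (Side-map inj₁ inj₂ (subst₂ (λ w w′ → Side N (w ⋗ w′) (w′ ⋗ w))
        (cong (α ,_) γ≡Qy) (cong₂ _,_ β≡Dy (sym α≡δ)) (act-⋗ b N {∞} {b 0 , 1} (∞⋗ (b 0)))))
      where
      γ≡Qy : γ ≡ Q * y
      γ≡Qy = trans γ≡yQ (*-comm y Q)
      β≡Dy : β ≡ D * y
      β≡Dy = *-cancelˡ-≡ β (D * y) Q (trans (sym Dγ≡Qβ) (trans (cong (D *_) γ≡Qy) (lemma D Q y)))
        where
        lemma : ∀ D Q y → D * (Q * y) ≡ Q * (D * y)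
        lemma D Q y = trans (sym (*-assoc D Q y)) (trans (cong (_* y) (*-comm D Q)) (*-assoc Q D y))

-- Convergents as rationals, and Dedekind cuts in integer terms.

-- Equality of numerator and denominator, not merely of value: it includes lowest terms, so the
-- entries of `w` are r_k and s_k themselves.
record IsFraction (p : ℚ) (w : ℕ × ℕ) : Set where
  constructor frac
  field
    ↥≡ : ↥ p ≡ + proj₁ w
    ↧≡ : ↧ₙ p ≡ proj₂ w

open IsFraction

/1-fraction : ∀ n → IsFraction (+ n / 1) (n , 1)
/1-fraction n = frac (cong ↥_ eq) (cong ↧ₙ_ eq)
  where
  eq : + n / 1 ≡ mkℚ (+ n) 0 (Coprimality.sym (Coprimality.1-coprimeTo n))
  eq = ℚₚ.normalize-coprime (Coprimality.sym (Coprimality.1-coprimeTo n))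

recip-fraction : ∀ {p u v} → 1 ≤ u → IsFraction p (u , v) → IsFraction (recip p) (v , u)
recip-fraction {mkℚ (+ suc u) d _} (s≤s _) (frac refl refl) = frac refl refl

-- No cancellation occurs: a common divisor of cd + u and d divides u as well.
+-fraction : ∀ c {p u v} → IsFraction p (u , v) → IsFraction (+ c / 1 ℚ.+ p) (c * v + u , v)
+-fraction c {p@(mkℚ (+ u) d-1 u⊥d)} {u} {d} (frac refl refl) = frac (cong ↥_ eq) (cong ↧ₙ_ eq)
  where
  c⊥1 : Coprime c 1
  c⊥1 = Coprimality.sym (Coprimality.1-coprimeTo c)
  coprime : Coprime (c * d + u) d
  coprime (i∣cd+u , i∣d) = Coprimality.recompute u⊥d (∣m+n∣m⇒∣n i∣cd+u (∣n⇒∣m*n c i∣d) , i∣d)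
  eq : + c / 1 ℚ.+ p ≡ mkℚ (+ (c * d + u)) d-1 coprime
  eq = begin
    + c / 1 ℚ.+ p             ≡⟨ cong (ℚ._+ p) (ℚₚ.normalize-coprime c⊥1) ⟩
    mkℚ (+ c) 0 c⊥1 ℚ.+ p     ≡⟨ ℚₚ./-cong
                                   (cong₂ ℤ._+_ (sym (ℤₚ.pos-* c d)) (ℤₚ.*-identityʳ (+ u))) (*-identityˡ d) ⟩
    + (c * d + u) / d     ≡⟨ ℚₚ.normalize-coprime coprime ⟩
    mkℚ (+ (c * d + u)) d-1 coprime ∎
    where open ≡-Reasoning

convergent-fraction : ∀ {a} → Positive a → ∀ k → IsFraction (convergent a k) (act a (suc k) ∞)
convergent-fraction {a} a⁺ zero    =
  subst (λ u → IsFraction (+ a 0 / 1) (u , 1))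
    (sym (trans (+-identityʳ (a 0 * 1)) (*-identityʳ (a 0)))) (/1-fraction (a 0))
convergent-fraction {a} a⁺ (suc k) = +-fraction (a 0)
  (recip-fraction (proj₂ (numerator-≥ {tail a} (λ i → a⁺ (suc i)) (suc k)))
    (convergent-fraction {tail a} (λ i → a⁺ (suc i)) k))

<⇒⊏ : ∀ {p w p′ w′} → IsFraction p w → IsFraction p′ w′ → p ℚ.< p′ → w ⊏ w′
<⇒⊏ {mkℚ _ _ _} {u , v} {mkℚ _ _ _} {u′ , v′} (frac refl refl) (frac refl refl) (*<* lt) = ℤₚ.drop‿+<+
  (subst₂ ℤ._<_ (sym (ℤₚ.pos-* u v′)) (sym (ℤₚ.pos-* u′ v)) lt)

toℚᵘ-square : ∀ p → toℚᵘ (p ℚ.* p) ℚᵘ.≃ toℚᵘ p ℚᵘ.* toℚᵘ p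
toℚᵘ-square p = ℚₚ.toℚᵘ-homo-* p p

module _ (D : ℕ) where
  private
    pos-square : ∀ u Q → + (Q * (u * u)) ≡ + u ℤ.* + u ℤ.* + Q
    pos-square u Q = trans (cong +_ (*-comm Q (u * u)))
      (trans (ℤₚ.pos-* (u * u) Q) (cong (ℤ._* + Q) (ℤₚ.pos-* u u)))

  square-< : ∀ Q .{{_ : NonZero Q}} {p u v} → IsFraction p (u , v) →
    Q * (u * u) < D * (v * v) → p ℚ.* p ℚ.< + D / Q
  square-< Q@(suc Q-1) {p@(mkℚ _ _ _)} {u} {v} (frac refl refl) lt = ℚₚ.toℚᵘ-cancel-<
    (ℚᵘₚ.<-respˡ-≃ (ℚᵘₚ.≃-sym (toℚᵘ-square p))
    (ℚᵘₚ.<-respʳ-≃ (ℚᵘₚ.≃-sym (ℚₚ.toℚᵘ-fromℚᵘ (mkℚᵘ (+ D) Q-1)))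
    (ℚᵘ.*<* (subst₂ ℤ._<_ (pos-square u Q) (ℤₚ.pos-* D (v * v)) (ℤ.+<+ lt)))))

  square-> : ∀ Q .{{_ : NonZero Q}} {p u v} → IsFraction p (u , v) →
    D * (v * v) < Q * (u * u) → + D / Q ℚ.< p ℚ.* p
  square-> Q@(suc Q-1) {p@(mkℚ _ _ _)} {u} {v} (frac refl refl) lt = ℚₚ.toℚᵘ-cancel-<
    (ℚᵘₚ.<-respʳ-≃ (ℚᵘₚ.≃-sym (toℚᵘ-square p))
    (ℚᵘₚ.<-respˡ-≃ (ℚᵘₚ.≃-sym (ℚₚ.toℚᵘ-fromℚᵘ (mkℚᵘ (+ D) Q-1)))
    (ℚᵘ.*<* (subst₂ ℤ._<_ (ℤₚ.pos-* D (v * v)) (pos-square u Q) (ℤ.+<+ lt)))))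

  square-≡ : ∀ Q .{{_ : NonZero Q}} {p u v} → IsFraction p (u , v) →
    Q * (u * u) ≡ D * (v * v) → p ℚ.* p ≡ + D / Q
  square-≡ Q@(suc Q-1) {p@(mkℚ _ _ _)} {u} {v} (frac refl refl) eq = ℚₚ.toℚᵘ-injective
    (ℚᵘₚ.≃-trans (toℚᵘ-square p)
    (ℚᵘₚ.≃-trans (ℚᵘ.*≡* (trans (sym (pos-square u Q)) (trans (cong +_ eq) (ℤₚ.pos-* D (v * v)))))
    (ℚᵘₚ.≃-sym (ℚₚ.toℚᵘ-fromℚᵘ (mkℚᵘ (+ D) Q-1)))))

  square-<⁻ : ∀ Q .{{_ : NonZero Q}} {p u v} → IsFraction p (u , v) →
    p ℚ.* p ℚ.< + D / Q → Q * (u * u) < D * (v * v)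
  square-<⁻ Q {p} {u} {v} p≡u/v lt with <-cmp (Q * (u * u)) (D * (v * v))
  ... | tri< l _ _ = l
  ... | tri≈ _ e _ = ⊥-elim (ℚₚ.<-irrefl (square-≡ Q p≡u/v e) lt)
  ... | tri> _ _ g = ⊥-elim (ℚₚ.<-asym lt (square-> Q p≡u/v g))

  square->⁻ : ∀ Q .{{_ : NonZero Q}} {p u v} → IsFraction p (u , v) →
    + D / Q ℚ.< p ℚ.* p → D * (v * v) < Q * (u * u)
  square->⁻ Q {p} {u} {v} p≡u/v lt with <-cmp (Q * (u * u)) (D * (v * v))
  ... | tri< l _ _ = ⊥-elim (ℚₚ.<-asym lt (square-< Q p≡u/v l))
  ... | tri≈ _ e _ = ⊥-elim (ℚₚ.<-irrefl (sym (square-≡ Q p≡u/v e)) lt)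
  ... | tri> _ _ g = g

fraction-positive : ∀ {p u v} → IsFraction p (u , v) → 1 ≤ u → 0ℚ ℚ.< p
fraction-positive {mkℚ (+ suc u) _ _} (frac refl refl) _ = *<* (ℤ.+<+ (s≤s z≤n))

1<D/Q⇒Q<D : ∀ {D Q} .{{_ : NonZero Q}} → 1ℚ ℚ.< + D / Q → Q < D
1<D/Q⇒Q<D {D} {Q} lt = subst₂ _<_ (*-identityʳ Q) (*-identityʳ D)
  (square-<⁻ D Q {1ℚ} (frac refl refl) lt)

module _ (D Q : ℕ) .{{_ : NonZero Q}} (1<D/Q : 1ℚ ℚ.< + D / Q) (irrational : ∀ x → x ℚ.* x ≢ + D / Q)
         {b : ℕ → ℕ} (b⁺ : Positive b) (converges : convergent b ⟶√ (+ D / Q)) where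
  private
    -- Convergence asks for a bound on each side of √(D/Q); `D` and -1 serve where only the other
    -- bound matters.
    D>√ : (+ D / 1) >√ (+ D / Q)
    D>√ = fraction-positive (/1-fraction D) (≤-<-trans z≤n (1<D/Q⇒Q<D {D} {Q} 1<D/Q)) ,
      square-> D Q (/1-fraction D)
      (begin-strict
        D * 1           <⟨ *-monoʳ-< D {{>-nonZero (≤-<-trans z≤n Q<D)}} (≤-<-trans (>-nonZero⁻¹ Q) Q<D) ⟩
        D * D           ≤⟨ m≤n*m (D * D) Q ⟩
        Q * (D * D)   ∎)
      where
      open ≤-Reasoning
      Q<D = 1<D/Q⇒Q<D {D} {Q} 1<D/Q

    -1<√ : (-[1+ 0 ] / 1) <√ (+ D / Q)
    -1<√ = inj₁ (*<* ℤ.-<+)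

    fraction : ∀ k → IsFraction (convergent b k) (act b (suc k) ∞)
    fraction = convergent-fraction b⁺

    later : ∀ k N → act b (suc (k + N)) ∞ ≡ act b (suc k) (act (drop (suc k) b) N ∞)
    later k N = act-+ b (suc k) N ∞

    -- A convergent on the wrong side of √(D/Q) would be a bound that the later
    -- convergents, which lie on its other side, eventually violate.

    above : ∀ k {w} → IsFraction (convergent b k) w →
      (∀ w′ → act b (suc k) w′ ⊑ w) → Above (√-cut D Q) w
    above k {u , v} c≡u/v later-⊑ with <-cmp (Q * (u * u)) (D * (v * v))
    ... | tri> _ _ g = g
    ... | tri≈ _ e _ = ⊥-elim (irrational (convergent b k) (square-≡ D Q c≡u/v e))
    ... | tri< l _ _ with converges (inj₂ (square-< D Q c≡u/v l)) D>√
    ... | N , bounds = ⊥-elim (<⇒≱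
            (<⇒⊏ c≡u/v (subst (IsFraction _) (later k N) (fraction (k + N)))
              (proj₁ (bounds (k + N) (m≤n+m N k))))
            (later-⊑ (act (drop (suc k) b) N ∞)))

    below : ∀ k {w} → IsFraction (convergent b k) w → 1 ≤ proj₁ w →
      (∀ w′ → w ⊑ act b (suc k) w′) → Below (√-cut D Q) w
    below k {u , v} c≡u/v 1≤u later-⊒ with <-cmp (Q * (u * u)) (D * (v * v))
    ... | tri< l _ _ = l
    ... | tri≈ _ e _ = ⊥-elim (irrational (convergent b k) (square-≡ D Q c≡u/v e))
    ... | tri> _ _ g with converges -1<√ (fraction-positive c≡u/v 1≤u , square-> D Q c≡u/v g)
    ... | N , bounds = ⊥-elim (<⇒≱
            (<⇒⊏ (subst (IsFraction _) (later k N) (fraction (k + N))) c≡u/v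
              (proj₂ (bounds (k + N) (m≤n+m N k))))
            (later-⊒ (act (drop (suc k) b) N ∞)))

  -- Irrationality makes the sides strict: a convergent equal to √(D/Q) would lie on neither.
  converges⇒Expands : Expands (√-cut D Q) b
  converges⇒Expands zero    = here (subst₂ _<_ (sym (*-zeroʳ D)) (sym (*-identityʳ Q)) (>-nonZero⁻¹ Q))
  converges⇒Expands (suc k) = Side-map
    (above k (fraction k)) (below k (fraction k) (proj₂ (numerator-≥ b⁺ (suc k)))) (act-⊑ b (suc k))

-- Units of ℤ[√d] and the inequality 1 < x + y√d.

toℚᵘ-affine : ∀ x y l → toℚᵘ (x / 1 ℚ.+ y / 1 ℚ.* l) ℚᵘ.≃ mkℚᵘ x 0 ℚᵘ.+ mkℚᵘ y 0 ℚᵘ.* toℚᵘ l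
toℚᵘ-affine x y l = ℚᵘₚ.≃-trans (ℚₚ.toℚᵘ-homo-+ (x / 1) (y / 1 ℚ.* l))
  (ℚᵘₚ.+-cong (ℚₚ.toℚᵘ-fromℚᵘ (mkℚᵘ x 0))
    (ℚᵘₚ.≃-trans (ℚₚ.toℚᵘ-homo-* (y / 1) l)
      (ℚᵘₚ.*-cong (ℚₚ.toℚᵘ-fromℚᵘ (mkℚᵘ y 0)) (ℚᵘₚ.≃-refl {toℚᵘ l}))))

private
  numerator-affine : ∀ x y n e → (x ℤ.* + (1 * e) ℤ.+ y ℤ.* n ℤ.* 1ℤ) ℤ.* 1ℤ ≡ x ℤ.* + e ℤ.+ y ℤ.* n
  numerator-affine x y n e rewrite *-identityˡ e = solve 4 (λ x y n e →
    (x :* e :+ y :* n :* con 1ℤ) :* con 1ℤ := x :* e :+ y :* n) refl x y n (+ e)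
    where open ℤ-Solver.+-*-Solver

  denominator-affine : ∀ e → 1ℤ ℤ.* + (1 * (1 * e)) ≡ + e
  denominator-affine e = trans (ℤₚ.*-identityˡ _)
    (cong +_ (trans (*-identityˡ (1 * e)) (*-identityˡ e)))

1<affine⁻ : ∀ x y l → 1ℚ ℚ.< x / 1 ℚ.+ y / 1 ℚ.* l → ↧ l ℤ.< x ℤ.* ↧ l ℤ.+ y ℤ.* ↥ l
1<affine⁻ x y l@(mkℚ n e-1 _) lt = subst₂ ℤ._<_ (denominator-affine (suc e-1)) (numerator-affine x y n (suc e-1))
  (ℚᵘₚ.drop-*<* (ℚᵘₚ.<-respʳ-≃ (toℚᵘ-affine x y l) (ℚₚ.toℚᵘ-mono-< lt)))

1<affine : ∀ x y l → ↧ l ℤ.< x ℤ.* ↧ l ℤ.+ y ℤ.* ↥ l → 1ℚ ℚ.< x / 1 ℚ.+ y / 1 ℚ.* l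
1<affine x y l@(mkℚ n e-1 _) lt = ℚₚ.toℚᵘ-cancel-< (ℚᵘₚ.<-respʳ-≃ (ℚᵘₚ.≃-sym (toℚᵘ-affine x y l))
  (ℚᵘ.*<* (subst₂ ℤ._<_ (sym (denominator-affine (suc e-1))) (sym (numerator-affine x y n (suc e-1))) lt)))

Norm±1 : ℕ → ℕ → ℕ → Set
Norm±1 d x y = x * x ≡ suc (d * (y * y)) ⊎ d * (y * y) ≡ suc (x * x)

norm : ∀ {d} → ℤ[√ d ] → ℤ
norm {d} (x + y √) = x ℤ.* x ℤ.- + d ℤ.* (y ℤ.* y)

norm-· : ∀ {d} (z z′ : ℤ[√ d ]) → norm z ℤ.* norm z′ ≡ norm (z · z′)
norm-· {d} (x + y √) (x′ + y′ √) = solve 5 (λ d x y x′ y′ →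
  (x :* x :- d :* (y :* y)) :* (x′ :* x′ :- d :* (y′ :* y′)) :=
  (x :* x′ :+ d :* (y :* y′)) :* (x :* x′ :+ d :* (y :* y′)) :-
  d :* ((x :* y′ :+ y :* x′) :* (x :* y′ :+ y :* x′))) refl (+ d) x y x′ y′
  where open ℤ-Solver.+-*-Solver

∣difference∣≡1 : ∀ m n → ℤ.∣ + m ℤ.- + n ∣ ≡ 1 → m ≡ suc n ⊎ n ≡ suc m
∣difference∣≡1 m n h with ≤-total m n
... | inj₁ m≤n with m≤n⇒∃[o]m+o≡n m≤n
...   | o , refl = inj₂ (trans (cong (λ t → m + t)
  (trans (sym (trans (cong ℤ.∣_∣ difference) (ℤₚ.∣-i∣≡∣i∣ (+ o)))) h)) (+-comm m 1))
  where
  open ℤ-Solver.+-*-Solver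
  difference : + m ℤ.- + (m + o) ≡ ℤ.- + o
  difference = solve 2 (λ m o → m :- (m :+ o) := :- o) refl (+ m) (+ o)
∣difference∣≡1 m n h | inj₂ n≤m with m≤n⇒∃[o]m+o≡n n≤m
...   | o , refl = inj₁ (trans (cong (λ t → n + t) (trans (sym (cong ℤ.∣_∣ difference)) h)) (+-comm n 1))
  where
  open ℤ-Solver.+-*-Solver
  difference : + (n + o) ℤ.- + n ≡ + o
  difference = solve 2 (λ n o → n :+ o :- n := o) refl (+ n) (+ o)

unit⇒Norm±1 : ∀ {d} (z : ℤ[√ d ]) → IsUnit z → Norm±1 d ℤ.∣ re z ∣ ℤ.∣ im z ∣
unit⇒Norm±1 {d} z@(x + y √) (z⁻¹ , _ , zz⁻¹≡1) = ∣difference∣≡1 _ _ (trans (cong ℤ.∣_∣ (sym norm≡)) ∣norm∣≡1)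
  where
  norm≡ : norm z ≡ + (ℤ.∣ x ∣ * ℤ.∣ x ∣) ℤ.- + (d * (ℤ.∣ y ∣ * ℤ.∣ y ∣))
  norm≡ = cong₂ ℤ._-_ (square-nonneg x)
    (trans (cong (+ d ℤ.*_) (square-nonneg y)) (sym (ℤₚ.pos-* d (ℤ.∣ y ∣ * ℤ.∣ y ∣))))
  ∣norm∣≡1 : ℤ.∣ norm z ∣ ≡ 1
  ∣norm∣≡1 = m*n≡1⇒m≡1 ℤ.∣ norm z ∣ ℤ.∣ norm z⁻¹ ∣
    (trans (sym (ℤₚ.abs-* (norm z) (norm z⁻¹))) (cong ℤ.∣_∣ (trans (norm-· z z⁻¹)
      (trans (cong norm zz⁻¹≡1)
        (solve 1 (λ d → con 1ℤ :* con 1ℤ :- d :* (con 0ℤ :* con 0ℤ) := con 1ℤ) refl (+ d))))))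
    where open ℤ-Solver.+-*-Solver

·-comm : ∀ {d} (z z′ : ℤ[√ d ]) → z · z′ ≡ z′ · z
·-comm {d} (x + y √) (x′ + y′ √) = cong₂ _+_√
  (solve 5 (λ d x y x′ y′ → x :* x′ :+ d :* (y :* y′) := x′ :* x :+ d :* (y′ :* y)) refl (+ d) x y x′ y′)
  (solve 4 (λ x y x′ y′ → x :* y′ :+ y :* x′ := x′ :* y :+ y′ :* x) refl x y x′ y′)
  where open ℤ-Solver.+-*-Solver

Norm±1⇒unit : ∀ {d} x y → Norm±1 d x y → IsUnit {d} ((+ x) + (+ y) √)
Norm±1⇒unit {d} x y n = inverse n , trans (·-comm (inverse n) _) (inverseʳ n) , inverseʳ n
  where
  open ℤ-Solver.+-*-Solver
  inverse : Norm±1 d x y → ℤ[√ d ]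
  inverse (inj₁ _) = (+ x) + (ℤ.- + y) √
  inverse (inj₂ _) = (ℤ.- + x) + (+ y) √

  pos-d*y² : + (d * (y * y)) ≡ + d ℤ.* (+ y ℤ.* + y)
  pos-d*y² = trans (ℤₚ.pos-* d (y * y)) (cong (+ d ℤ.*_) (ℤₚ.pos-* y y))

  inverseʳ : ∀ n → ((+ x) + (+ y) √) · inverse n ≡ one
  inverseʳ (inj₁ eq) = cong₂ _+_√
    (begin
      + x ℤ.* + x ℤ.+ + d ℤ.* (+ y ℤ.* ℤ.- + y)
        ≡⟨ solve 3 (λ d x y → x :* x :+ d :* (y :* :- y) := x :* x :- d :* (y :* y)) refl (+ d) (+ x) (+ y) ⟩
      + x ℤ.* + x ℤ.- + d ℤ.* (+ y ℤ.* + y)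
        ≡⟨ cong₂ ℤ._-_ (trans (sym (ℤₚ.pos-* x x)) (cong +_ eq)) (sym pos-d*y²) ⟩
      + suc (d * (y * y)) ℤ.- + (d * (y * y))
        ≡⟨ solve 1 (λ m → con 1ℤ :+ m :- m := con 1ℤ) refl (+ (d * (y * y))) ⟩
      1ℤ ∎)
    (solve 2 (λ x y → x :* :- y :+ y :* x := con 0ℤ) refl (+ x) (+ y))
    where open ≡-Reasoning
  inverseʳ (inj₂ eq) = cong₂ _+_√
    (begin
      + x ℤ.* ℤ.- + x ℤ.+ + d ℤ.* (+ y ℤ.* + y)
        ≡⟨ solve 3 (λ d x y → x :* :- x :+ d :* (y :* y) := d :* (y :* y) :- x :* x) refl (+ d) (+ x) (+ y) ⟩
      + d ℤ.* (+ y ℤ.* + y) ℤ.- + x ℤ.* + x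
        ≡⟨ cong₂ ℤ._-_ (trans (sym pos-d*y²) (cong +_ eq)) (sym (ℤₚ.pos-* x x)) ⟩
      + suc (x * x) ℤ.- + (x * x)
        ≡⟨ solve 1 (λ m → con 1ℤ :+ m :- m := con 1ℤ) refl (+ (x * x)) ⟩
      1ℤ ∎)
    (solve 2 (λ x y → x :* y :+ y :* :- x := con 0ℤ) refl (+ x) (+ y))
    where open ≡-Reasoning

1<affine-fraction : ∀ x y {l n e} → IsFraction l (n , e) → e < x * e + y * n →
  1ℚ ℚ.< + x / 1 ℚ.+ + y / 1 ℚ.* l
1<affine-fraction x y {l} {n} {e} (frac ↥l≡ ↧l≡) lt = 1<affine (+ x) (+ y) l
  (subst₂ (λ e n → + e ℤ.< + x ℤ.* + e ℤ.+ + y ℤ.* n) (sym ↧l≡) (sym ↥l≡)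
    (subst (+ e ℤ.<_) (cong₂ ℤ._+_ (ℤₚ.pos-* x e) (ℤₚ.pos-* y n)) (ℤ.+<+ lt)))

positive⇒1< : ∀ {d} x y → 1 < d → 1 ≤ x → 1 ≤ y → 1<_ {d} ((+ x) + (+ y) √)
-- As d > 1, the endpoints 1 and d enclose √d, and x + yt is at least 2 at both.
positive⇒1< {d} x y 1<d 1≤x 1≤y = 1ℚ , + d / 1 ,
  inj₂ (square-< d 1 {1ℚ} {1} {1} (frac refl refl) (subst (1 <_) (sym (*-identityʳ d)) 1<d)) ,
  (fraction-positive (/1-fraction d) (<⇒≤ 1<d) ,
   square-> d 1 (/1-fraction d) (subst₂ _<_ (sym (*-identityʳ d)) (sym (*-identityˡ (d * d)))
     (m<m*n d d {{>-nonZero (<⇒≤ 1<d)}} 1<d))) ,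
  1<affine-fraction x y {1ℚ} {1} {1} (frac refl refl) (1<x+yn 1 ≤-refl) ,
  1<affine-fraction x y (/1-fraction d) (1<x+yn d (<⇒≤ 1<d))
  where
  1<x+yn : ∀ n → 1 ≤ n → 1 < x * 1 + y * n
  1<x+yn n 1≤n = +-mono-≤ (*-mono-≤ 1≤x (≤-refl {1})) (*-mono-≤ 1≤y 1≤n)

module _ {d X Y N e : ℕ} where
  private
    regroup : ∀ a b → a * b * (a * b) ≡ a * a * (b * b)
    regroup = solve 2 (λ a b → a :* b :* (a :* b) := a :* a :* (b :* b)) refl
      where open ℕ-Solver.+-*-Solver

    swap-d : ∀ Y d e → Y * Y * (d * (e * e)) ≡ d * (Y * Y) * (e * e)
    swap-d = solve 3 (λ Y d e → Y :* Y :* (d :* (e :* e)) := d :* (Y :* Y) :* (e :* e)) refl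
      where open ℕ-Solver.+-*-Solver

  -- For N/e ≤ √d the hypothesis says X + 1 < Y√d; comparing squares multiplied by e² keeps the
  -- argument in ℕ.
  square-gap-above : e + X * e < Y * N → N * N ≤ d * (e * e) →
    suc X * suc X < d * (Y * Y)
  square-gap-above lt N²≤de² = *-cancelʳ-< (e * e) _ _ (begin-strict
    suc X * suc X * (e * e)       ≡⟨ regroup (suc X) e ⟨
    suc X * e * (suc X * e)       <⟨ *-mono-< lt lt ⟩
    Y * N * (Y * N)               ≡⟨ regroup Y N ⟩
    Y * Y * (N * N)               ≤⟨ *-monoʳ-≤ (Y * Y) N²≤de² ⟩
    Y * Y * (d * (e * e))       ≡⟨ swap-d Y d e ⟩
    d * (Y * Y) * (e * e)       ∎)
    where open ≤-Reasoning

  square-gap-below : e + Y * N < X * e → d * (e * e) ≤ N * N →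
    suc (d * (Y * Y)) < X * X
  square-gap-below lt de²≤N² = *-cancelʳ-< (e * e) _ _ (begin-strict
    e * e + d * (Y * Y) * (e * e)       ≡⟨ cong (λ t → e * e + t) (swap-d Y d e) ⟨
    e * e + Y * Y * (d * (e * e))       ≤⟨ +-monoʳ-≤ (e * e) (*-monoʳ-≤ (Y * Y) de²≤N²) ⟩
    e * e + Y * Y * (N * N)               ≡⟨ cong (λ t → e * e + t) (regroup Y N) ⟨
    e * e + Y * N * (Y * N)               ≤⟨ m≤m+n _ (2 * (e * (Y * N))) ⟩
    e * e + Y * N * (Y * N) + 2 * (e * (Y * N))
      ≡⟨ solve 2 (λ a b → a :* a :+ b :* b :+ con 2 :* (a :* b) := (a :+ b) :* (a :+ b)) refl e (Y * N) ⟩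
    (e + Y * N) * (e + Y * N)             <⟨ *-mono-< lt lt ⟩
    X * e * (X * e)                           ≡⟨ regroup X e ⟩
    X * X * (e * e)                           ∎)
    where
    open ≤-Reasoning
    open ℕ-Solver.+-*-Solver

i<j+k⇒i-j<k : ∀ {i} j k → i ℤ.< j ℤ.+ k → i ℤ.- j ℤ.< k
i<j+k⇒i-j<k {i} j k lt = subst (i ℤ.- j ℤ.<_)
  (solve 2 (λ j k → j :+ k :- j := k) refl j k) (ℤₚ.+-monoˡ-< (ℤ.- j) lt)
  where open ℤ-Solver.+-*-Solver

i<j+k⇒i-k<j : ∀ {i} j k → i ℤ.< j ℤ.+ k → i ℤ.- k ℤ.< j
i<j+k⇒i-k<j {i} j k lt = i<j+k⇒i-j<k k j (subst (i ℤ.<_) (ℤₚ.+-comm j k) lt)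

-- From l < √d one gets Y√d > X + 1, so dY² exceeds (X + 1)² and the norm cannot be ±1.
positive-re : ∀ d X Y l → l <√ (+ d / 1) → 1ℚ ℚ.< (ℤ.- + X) / 1 ℚ.+ + Y / 1 ℚ.* l → Norm±1 d X Y → ⊥
positive-re d X Y l@(mkℚ n e-1 _) l<√d 1<l norm±1 = contradiction n refl (subst (ℤ._< + Y ℤ.* n)
  (trans (solve 2 (λ e x → e :- (:- x) :* e := e :+ x :* e) refl (+ e) (+ X))
    (cong (λ i → + e ℤ.+ i) (sym (ℤₚ.pos-* X e))))
  (i<j+k⇒i-j<k (ℤ.- + X ℤ.* + e) (+ Y ℤ.* n) (1<affine⁻ (ℤ.- + X) (+ Y) l 1<l)))
  where
  open ℤ-Solver.+-*-Solver
  e = suc e-1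
  Y*neg : ∀ {m} Y k → + m ℤ.< + Y ℤ.* -[1+ k ] → ⊥
  Y*neg zero    k (ℤ.+<+ ())
  Y*neg (suc _) k ()
  N²≤ : ∀ {N} → n ≡ + N → l <√ (+ d / 1) → N * N ≤ d * (e * e)
  N²≤ {N} refl (inj₁ (*<* l<0)) = ⊥-elim (ℤₚ.≤⇒≯ (ℤ.+≤+ z≤n) (subst (ℤ._< 0ℤ) (ℤₚ.*-identityʳ (+ N)) l<0))
  N²≤ {N} refl (inj₂ l²<d) = <⇒≤ (subst (_< d * (e * e)) (*-identityˡ (N * N))
    (square-<⁻ d 1 {l} {N} {e} (frac refl refl) l²<d))
  contradiction : ∀ m → n ≡ m → + (e + X * e) ℤ.< + Y ℤ.* m → ⊥
  contradiction -[1+ k ] _  lt = Y*neg Y k lt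
  contradiction (+ N)    eq lt = exclude norm±1
    where
    gap : suc X * suc X < d * (Y * Y)
    gap = square-gap-above {d} {X} {Y} {N} {e}
      (ℤₚ.drop‿+<+ (subst (_ ℤ.<_) (sym (ℤₚ.pos-* Y N)) lt)) (N²≤ eq l<√d)
    X²<[1+X]² : X * X < suc X * suc X
    X²<[1+X]² = *-mono-< (n<1+n X) (n<1+n X)
    exclude : Norm±1 d X Y → ⊥
    exclude (inj₁ h) = <-asym (subst (d * (Y * Y) <_) (sym h) ≤-refl) (<-trans X²<[1+X]² gap)
    exclude (inj₂ h) = <-irrefl refl (<-≤-trans (subst (suc X * suc X <_) h gap) X²<[1+X]²)

-- From u > √d one gets x > 1 + Y√d, so x² exceeds dY² + 1 and the norm cannot be ±1.
positive-im : ∀ d x Y u → u >√ (+ d / 1) → 1ℚ ℚ.< x / 1 ℚ.+ (ℤ.- + Y) / 1 ℚ.* u → Norm±1 d ℤ.∣ x ∣ Y → ⊥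
positive-im d x Y u@(mkℚ (+ zero) e-1 _) (*<* (ℤ.+<+ ()) , _) 1<u norm±1
positive-im d x Y u@(mkℚ -[1+ _ ] e-1 _) (*<* () , _) 1<u norm±1
positive-im d x Y u@(mkℚ (+ N@(suc _)) e-1 _) (_ , d<u²) 1<u norm±1 = contradiction x norm±1
  (subst (ℤ._< x ℤ.* + e)
    (trans (solve 3 (λ e y n → e :- (:- y) :* n := e :+ y :* n) refl (+ e) (+ Y) (+ N))
      (cong (λ i → + e ℤ.+ i) (sym (ℤₚ.pos-* Y N))))
    (i<j+k⇒i-k<j (x ℤ.* + e) (ℤ.- + Y ℤ.* + N) (1<affine⁻ x (ℤ.- + Y) u 1<u)))
  where
  open ℤ-Solver.+-*-Solver
  e = suc e-1
  contradiction : ∀ x → Norm±1 d ℤ.∣ x ∣ Y → + (e + Y * N) ℤ.< x ℤ.* + e → ⊥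
  contradiction (+ X) norm±1 lt = exclude norm±1
    where
    gap : suc (d * (Y * Y)) < X * X
    gap = square-gap-below {d} {X} {Y} {N} {e}
      (ℤₚ.drop‿+<+ (subst (_ ℤ.<_) (sym (ℤₚ.pos-* X e)) lt))
      (subst (d * (e * e) ≤_) (*-identityˡ (N * N))
        (<⇒≤ (square->⁻ d 1 {u} {N} {e} (frac refl refl) d<u²)))
    exclude : Norm±1 d X Y → ⊥
    exclude (inj₁ h) = <-irrefl (sym h) gap
    exclude (inj₂ h) = <-asym gap (≤-trans (s≤s (n≤1+n _)) (≤-reflexive (cong suc (sym h))))

nonzero-im : ∀ d x l → 1ℚ ℚ.< + x / 1 ℚ.+ 0ℤ / 1 ℚ.* l → Norm±1 d x 0 → ⊥
nonzero-im d x l 1<l (inj₂ h) with () ← trans (sym (*-zeroʳ d)) h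
nonzero-im d x l 1<l (inj₁ h) = ℤₚ.<-irrefl (sym x*e+0) (1<affine⁻ (+ x) 0ℤ l 1<l)
  where
  x≡1 : x ≡ 1
  x≡1 = m*n≡1⇒m≡1 x x (trans h (cong suc (*-zeroʳ d)))
  x*e+0 : + x ℤ.* ↧ l ℤ.+ 0ℤ ℤ.* ↥ l ≡ ↧ l
  x*e+0 = trans (cong (λ x → + x ℤ.* ↧ l ℤ.+ 0ℤ ℤ.* ↥ l) x≡1)
    (solve 2 (λ e n → con 1ℤ :* e :+ con 0ℤ :* n := e) refl (↧ l) (↥ l))
    where open ℤ-Solver.+-*-Solver

-- A unit, its inverse and their negatives are the numbers ±x ± y√d, and at most one of them exceeds
-- 1, so the signs are forced. Each excluded case uses an endpoint at which x + yt does not exceed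
-- its value at √d: the upper one for negative y, the lower one otherwise.
1<⇒positive : ∀ {d} (z : ℤ[√ d ]) → IsUnit z → 1< z →
  ∃₂ λ x y → z ≡ (+ x) + (+ y) √ × 1 ≤ y × Norm±1 d x y
1<⇒positive {d} z@(x + -[1+ y ] √) isUnit (_ , u , _ , u>√d , _ , 1<u) =
  ⊥-elim (positive-im d x (suc y) u u>√d 1<u (unit⇒Norm±1 z isUnit))
1<⇒positive {d} z@((+ x) + (+ suc y) √) isUnit _ = x , suc y , refl , s≤s z≤n , unit⇒Norm±1 z isUnit
1<⇒positive {d} z@(-[1+ x ] + (+ y) √) isUnit (l , _ , l<√d , _ , 1<l , _) =
  ⊥-elim (positive-re d (suc x) y l l<√d 1<l (unit⇒Norm±1 z isUnit))
1<⇒positive {d} z@((+ x) + (+ zero) √) isUnit (l , _ , _ , _ , 1<l , _) =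
  ⊥-elim (nonzero-im d x l 1<l (unit⇒Norm±1 z isUnit))

-- Expansions given by a finite block.

lookup-∷ʳ-All : ∀ {P : ℕ → Set} {m} {bs : Vec ℕ m} {x} → All P bs → P x → ∀ i → P (lookup (bs ∷ʳ x) i)
lookup-∷ʳ-All []         px Fin.zero    = px
lookup-∷ʳ-All (pb ∷ _)   px Fin.zero    = pb
lookup-∷ʳ-All (_  ∷ pbs) px (Fin.suc i) = lookup-∷ʳ-All pbs px i

lookup-∷ʳ-last : ∀ {m} (bs : Vec ℕ m) x i → toℕ i ≡ m → lookup (bs ∷ʳ x) i ≡ x
lookup-∷ʳ-last []       x Fin.zero    _  = refl
lookup-∷ʳ-last (b ∷ bs) x (Fin.suc i) eq = lookup-∷ʳ-last bs x i (suc-injective eq)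

lookup-tabulate-∷ʳ : ∀ r (f : ℕ → ℕ) i → lookup (tabulate {n = r} (f ∘ toℕ) ∷ʳ f r) i ≡ f (toℕ i)
lookup-tabulate-∷ʳ zero    f Fin.zero    = refl
lookup-tabulate-∷ʳ (suc r) f Fin.zero    = refl
lookup-tabulate-∷ʳ (suc r) f (Fin.suc i) = lookup-tabulate-∷ʳ r (f ∘ suc) i

convergent-cong : ∀ {a b} → (∀ i → a i ≡ b i) → ∀ k → convergent a k ≡ convergent b k
convergent-cong a≗b zero    = cong (λ c → + c / 1) (a≗b 0)
convergent-cong a≗b (suc k) = cong₂ (λ c p → + c / 1 ℚ.+ recip p) (a≗b 0) (convergent-cong (a≗b ∘ suc) k)

module _ {m b₀ : ℕ} (bs : Vec ℕ m) where
  private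
    b = periodic b₀ bs

  periodic-Positive : 1 ≤ b₀ → All (1 ≤_) bs → Positive b
  periodic-Positive b₀⁺ bs⁺ zero    = b₀⁺
  periodic-Positive b₀⁺ bs⁺ (suc i) =
    lookup-∷ʳ-All bs⁺ (≤-trans b₀⁺ (m≤m+n b₀ (b₀ + 0))) (i mod suc m)

  periodic-Period : Period b (suc m)
  periodic-Period = period λ i → cong (lookup (bs ∷ʳ (2 * b₀)))
    (fromℕ<-cong _ _ (trans (cong (_% suc m) (trans (+-suc m i) (+-comm (suc m) i))) ([m+n]%n≡m%n i (suc m)))
      (m%n<n (m + suc i) (suc m)) (m%n<n i (suc m)))

  periodic-last : b (suc m) ≡ b 0 + b 0
  periodic-last = trans
    (lookup-∷ʳ-last bs (2 * b₀) (m mod suc m)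
      (trans (toℕ-fromℕ< (m%n<n m (suc m))) (m<n⇒m%n≡m (n<1+n m))))
    (cong (λ t → b₀ + t) (+-identityʳ b₀))

periodic-tabulate : ∀ {b r} → Period b (suc r) → b (suc r) ≡ b 0 + b 0 →
  ∀ i → periodic (b 0) (tabulate {n = r} (λ j → b (suc (toℕ j)))) i ≡ b i
periodic-tabulate                 hr last zero    = refl
periodic-tabulate {b} {r} hr last (suc i) = begin
  lookup (tabulate (λ j → b (suc (toℕ j))) ∷ʳ (2 * b 0)) (i mod suc r)
    ≡⟨ cong (λ x → lookup (tabulate (λ j → b (suc (toℕ j))) ∷ʳ x) (i mod suc r))
            (trans (cong (λ t → b 0 + t) (+-identityʳ (b 0))) (sym last)) ⟩
  lookup (tabulate (λ j → b (suc (toℕ j))) ∷ʳ b (suc r)) (i mod suc r)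
    ≡⟨ lookup-tabulate-∷ʳ r (b ∘ suc) (i mod suc r) ⟩
  b (suc (toℕ (i mod suc r)))
    ≡⟨ cong (b ∘ suc) (toℕ-fromℕ< (m%n<n i (suc r))) ⟩
  b (suc (i % suc r))
    ≡⟨ Period.repeats (Period-* hr (i div suc r)) (i % suc r) ⟨
  b (i div suc r * suc r + suc (i % suc r))
    ≡⟨ cong b (trans (+-suc _ _) (cong suc (trans (+-comm _ (i % suc r)) (sym (m≡m%n+[m/n]*n i (suc r)))))) ⟩
  b (suc i) ∎
  where open ≡-Reasoning

-- Every period of length `suc r` comes from a block of r terms: by `Period-last` it too ends in
-- 2b₀, so the block expands the same number and minimality of m applies.
least-expansion⇒LeastPeriod : ∀ {ρ m b₀} {bs : Vec ℕ m} → √ ρ ≐[ b₀ , bs ] →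
  (∀ m′ b₀′ (bs′ : Vec ℕ m′) → √ ρ ≐[ b₀′ , bs′ ] → m ≤ m′) → LeastPeriod (periodic b₀ bs) (suc m)
least-expansion⇒LeastPeriod {ρ} {m} {b₀} {bs} ex minimal r hr = s≤s (minimal r b₀ bs′ record
  { b₀-positive = b₀-positive
  ; bs-positive = All.tabulate⁺ (λ j → periodic-Positive bs b₀-positive bs-positive (suc (toℕ j)))
  ; converges   = λ l<√ u>√ → let N , bounds = converges l<√ u>√ in
      N , λ k N≤k → subst (λ c → _ ℚ.< c × c ℚ.< _) (sym (convergent-cong same k)) (bounds k N≤k)
  })
  where
  open √_≐[_,_] ex
  b = periodic b₀ bs
  bs′ = tabulate {n = r} (λ j → b (suc (toℕ j)))
  same : ∀ i → periodic b₀ bs′ i ≡ b i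
  same = periodic-tabulate {b} hr (trans (Period-last hr (periodic-Period {m} {b₀} bs)) (periodic-last {m} {b₀} bs))

-- Units of ℤ[√D₂] and ends of periods.

D*y*[Q*y] : ∀ D Q y → D * y * (Q * y) ≡ D * Q * (y * y)
D*y*[Q*y] = solve 3 (λ D Q y → D :* y :* (Q :* y) := D :* Q :* (y :* y)) refl
  where open ℕ-Solver.+-*-Solver

Norm±1⇒IsPellSolution : ∀ D Q {x y} → Norm±1 (D * Q) x y → IsPellSolution D Q x y
Norm±1⇒IsPellSolution D Q {x} {y} = Sum.map
  (λ h → trans h (cong suc (sym (D*y*[Q*y] D Q y)))) (trans (D*y*[Q*y] D Q y))

IsPellSolution⇒Norm±1 : ∀ D Q {x y} → IsPellSolution D Q x y → Norm±1 (D * Q) x y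
IsPellSolution⇒Norm±1 D Q {x} {y} = Sum.map
  (λ h → trans h (cong suc (D*y*[Q*y] D Q y))) (trans (sym (D*y*[Q*y] D Q y)))

module _ {D Q q : ℕ} .{{_ : NonZero D}} .{{_ : NonZero Q}} .{{_ : NonZero q}}
  (D⊥Q : Coprime D Q) (1<D/Q : 1ℚ ℚ.< + D / Q) (irrational : ∀ x → x ℚ.* x ≢ + D / Q)
  (least-q : IsLeastDivisorWithMultipleSquare Q q)
  {m b₀ : ℕ} {bs : Vec ℕ m} (expansion : √ (+ D / Q) ≐[ b₀ , bs ]) where

  open √_≐[_,_] expansion
  open IsLeastDivisorWithMultipleSquare least-q

  private
    b = periodic b₀ bs

    b⁺ : Positive b
    b⁺ = periodic-Positive bs b₀-positive bs-positive

    expands : Expands (√-cut D Q) b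
    expands = converges⇒Expands D Q 1<D/Q irrational b⁺ converges

    Q<D : Q < D
    Q<D = 1<D/Q⇒Q<D {D} {Q} 1<D/Q

    include′ : ℤ[√ D₂ D Q ] → ℤ[√ D₁ D Q q ]
    include′ = include (Q div q) (D₂≡D₁[Q/q]² D Q q least-q)

    -- Inclusion multiplies y by Q/q, so the condition sq = s_k becomes Qy = s_k, the lower entry of
    -- the first column of T.
    y*[Q/q]*q : ∀ y → + y ℤ.* + (Q div q) ℤ.* + q ≡ + (Q * y)
    y*[Q/q]*q y = begin
      + y ℤ.* + (Q div q) ℤ.* + q     ≡⟨ cong (ℤ._* + q) (ℤₚ.pos-* y (Q div q)) ⟨
      + (y * (Q div q)) ℤ.* + q     ≡⟨ ℤₚ.pos-* (y * (Q div q)) q ⟨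
      + (y * (Q div q) * q)       ≡⟨ cong +_ (*-assoc y (Q div q) q) ⟩
      + (y * (Q div q * q))       ≡⟨ cong (λ t → + (y * t)) (m/n*n≡m q∣Q) ⟩
      + (y * Q)                     ≡⟨ cong +_ (*-comm y Q) ⟩
      + (Q * y)                     ∎
      where open ≡-Reasoning

  EndOfPeriod : ℕ → ℤ[√ D₁ D Q q ] → Set
  EndOfPeriod k z = re z ≡ ↥ (convergent b k) × im z ℤ.* + q ≡ ↧ (convergent b k)

  fraction⇒EndOfPeriod : ∀ k {x y} → (x , Q * y) ≡ act b (suc k) ∞ →
    EndOfPeriod k (include′ ((+ x) + (+ y) √))
  fraction⇒EndOfPeriod k {x} {y} eq =
    sym (↥≡ fraction) , trans (y*[Q/q]*q y) (cong +_ (sym (↧≡ fraction)))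
    where
    open IsFraction
    fraction : IsFraction (convergent b k) (x , Q * y)
    fraction = subst (IsFraction (convergent b k)) (sym eq) (convergent-fraction {b} b⁺ k)

  unit⇒end-of-period : (∀ m′ b₀′ (bs′ : Vec ℕ m′) → √ (+ D / Q) ≐[ b₀′ , bs′ ] → m ≤ m′) →
    ∀ u → IsUnit u → 1< u → ∃ λ l → 1 ≤ l × EndOfPeriod (l * suc m ∸ 1) (include′ u)
  unit⇒end-of-period minimal u isUnit 1<u =
    let x , y , u≡ , 1≤y , norm±1 = 1<⇒positive {D * Q} u isUnit 1<u
        l , eq = pell-end-of-period {D} {Q} {b} b⁺ expands {m} {x} {y} {{>-nonZero 1≤y}}
          (periodic-Period {m} {b₀} bs) (least-expansion⇒LeastPeriod expansion minimal)
          Q<D (Norm±1⇒IsPellSolution D Q {x} {y} norm±1)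
        -- This is `suc l * suc m ∸ 1` reduced: the convergent of index k uses k + 1 factors.
        k = m + l * suc m
    in suc l , s≤s z≤n ,
       subst (λ u → EndOfPeriod k (include′ u)) (sym u≡) (fraction⇒EndOfPeriod k eq)

  end-of-period-unit : ∀ l → 1 ≤ l →
    ∃₂ λ x y → IsFraction (convergent b (l * suc m ∸ 1)) (x , Q * y) ×
      1 ≤ x × 1 ≤ y × IsPellSolution D Q x y
  end-of-period-unit (suc l) _ =
    let y , γ≡Qy , 1≤y , pell = period-unit {b} b⁺ hn last {D} {Q} D⊥Q expands in
    proj₁ (act b (suc n) ∞) , y ,
    subst (λ γ → IsFraction (convergent b n) (proj₁ (act b (suc n) ∞) , γ)) γ≡Qy
      (convergent-fraction {b} b⁺ n) ,
    proj₂ (numerator-≥ {b} b⁺ (suc n)) , 1≤y , pell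
    where
    n = m + l * suc m
    hn : Period b (suc n)
    hn = Period-* (periodic-Period {m} {b₀} bs) (suc l)
    last : b (suc n) ≡ b 0 + b 0
    last = trans (Period-last hn (periodic-Period {m} {b₀} bs)) (periodic-last {m} {b₀} bs)

  end-of-period⇒unit : ∀ l → 1 ≤ l → ∀ z → EndOfPeriod (l * suc m ∸ 1) z →
    ∃ λ u → IsUnit u × 1< u × include′ u ≡ z
  end-of-period⇒unit l 1≤l z (re≡ , im≡) with end-of-period-unit l 1≤l
  ... | x , y , frac ↥≡x ↧≡Qy , 1≤x , 1≤y , pell =
    (+ x) + (+ y) √ ,
    Norm±1⇒unit x y (IsPellSolution⇒Norm±1 D Q {x} {y} pell) ,
    positive⇒1< x y (≤-<-trans (>-nonZero⁻¹ Q) (<-≤-trans Q<D (m≤m*n D Q))) 1≤x 1≤y ,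
    cong₂ _+_√ (sym (trans re≡ ↥≡x))
      -- The end-of-period condition fixes only `im z` times q; cancelling the nonzero q recovers
      -- `im z`.
      (ℤₚ.*-cancelʳ-≡ _ (im z) (+ q) (trans (y*[Q/q]*q y) (sym (trans im≡ (cong +_ ↧≡Qy)))))

  q∣denominator : ∀ l → 1 ≤ l → q ∣ ↧ₙ (convergent b (l * suc m ∸ 1))
  q∣denominator l 1≤l with end-of-period-unit l 1≤l
  ... | x , y , frac _ ↧≡Qy , _ = subst (q ∣_) (sym ↧≡Qy) (∣m⇒∣m*n y q∣Q)

theorem2 :
  (D Q : ℕ) .{{_ : NonZero D}} .{{_ : NonZero Q}} →
  Coprime D Q →
  1ℚ <ℚ + D / Q →
  (∀ (x : ℚ) → x *ℚ x ≢ + D / Q) →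
  (q : ℕ) .{{_ : NonZero q}} (q-least : IsLeastDivisorWithMultipleSquare Q q) →
  (m b₀ : ℕ) (bs : Vec ℕ m) →
  √ (+ D / Q) ≐[ b₀ , bs ] →
  (∀ m′ b₀′ (bs′ : Vec ℕ m′) → √ (+ D / Q) ≐[ b₀′ , bs′ ] → m ≤ m′) →
  let r/s : ℕ → ℚ
      r/s = convergent (periodic b₀ bs)
      Z[√D₂]⊆Z[√D₁] : ℤ[√ D₂ D Q ] → ℤ[√ D₁ D Q q ]
      Z[√D₂]⊆Z[√D₁] = include (Q div q) (D₂≡D₁[Q/q]² D Q q q-least)
  in
  (∀ (z : ℤ[√ D₁ D Q q ]) →
    (∃ λ (u : ℤ[√ D₂ D Q ]) → IsUnit u × 1< u × Z[√D₂]⊆Z[√D₁] u ≡ z)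
    ⇔
    (∃ λ (l : ℕ) → 1 ≤ l ×
      re z ≡ ↥ (r/s (l * suc m ∸ 1)) ×
      im z *ℤ + q ≡ ↧ (r/s (l * suc m ∸ 1))))
  ×
  (∀ (l : ℕ) → 1 ≤ l → q ∣ ↧ₙ (r/s (l * suc m ∸ 1)))
theorem2 D Q D⊥Q 1<D/Q irrational q q-least m b₀ bs expansion minimal =
  (λ z → mk⇔
    (λ { (u , isUnit , 1<u , refl) →
      unit⇒end-of-period D⊥Q 1<D/Q irrational q-least expansion minimal u isUnit 1<u })
    (λ { (l , 1≤l , end) →
      end-of-period⇒unit D⊥Q 1<D/Q irrational q-least expansion l 1≤l z end })) ,
  q∣denominator D⊥Q 1<D/Q irrational q-least expansion
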